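{- Let $a,b,c,d,e,r$ be complex variables and $j$ a non-negative integer, and put $q=1-r$. Assume that none of the denominator factors in the identity below has vanishing constant term in $r$. Then the following holds as an identity of convergent power series in $a$ and $r$: \[ \sum_{k\ge0}\frac{(q^j,1-a,b,c;q)_k}{(q,d,e,q^{j+1}(1-a)bc/(de);q)_k}\,q^k =\frac{(q/e,\;q(1-a)bc/(de);q)_j}{(q(1-a)/e,\;qbc/(de);q)_j}\sum_{k\ge0}\frac{(q^j,1-a,d/b,d/c;q)_k}{(q,d,de/(bc),q^{j+1}(1-a)/e;q)_k}\,q^k . \] In basic hypergeometric notation: ${}_4\phi_3\!\left[\begin{matrix}q^j,1-a,b,c\\ d,e,q^{j+1}(1-a)bc/de\end{matrix};q,q\right]=\frac{(q/e,q(1-a)bc/de;q)_j}{(q(1-a)/e,qbc/de;q)_j}\,{}_4\phi_3\!\left[\begin{matrix}q^j,1-a,d/b,d/c\\ d,de/bc,q^{j+1}(1-a)/e\end{matrix};q,q\right]$ with $q=1-r$.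
   Context: For an indeterminate $a$, base $q$ and non-negative integer $k$, $(a;q)_k=\prod_{i=1}^{k}(1-aq^{i-1})$, and $(a_1,\dots,a_m;q)_k=(a_1;q)_k\cdots(a_m;q)_k$. The series ${}_4\phi_3\!\left[\begin{matrix}a_1,a_2,a_3,a_4\\ b_1,b_2,b_3\end{matrix};q,z\right]=\sum_{k\ge0}\frac{(a_1,a_2,a_3,a_4;q)_k}{(q,b_1,b_2,b_3;q)_k}z^k$. Here the base is $q=1-r$ and all quantities are expanded as power series around $r=0$ (i.e. around $q=1$). -}

module Defs where

open import Level using (Level; suc; _⊔_)
open import Data.Nat as ℕ using (ℕ; zero; _∸_)
import Data.Nat
open import Relation.Nullary using (¬_)
open import Algebra.Bundles using (CommutativeRing)

_×1 : ∀ {c ℓ} (R : CommutativeRing c ℓ) → ℕ → CommutativeRing.Carrier R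
_×1 R zero = CommutativeRing.0# R
_×1 R (ℕ.suc n) = CommutativeRing._+_ R (CommutativeRing.1# R) (_×1 R n)

-- A field of characteristic zero (stand-in for ℂ).
-- The inverse is a total function, specified only on nonzero elements.
record CharZeroField (c ℓ : Level) : Set (suc (c ⊔ ℓ)) where
  field
    commRing : CommutativeRing c ℓ
  open CommutativeRing commRing public
  field
    _⁻¹       : Carrier → Carrier
    ⁻¹-inverse : ∀ x → ¬ (x ≈ 0#) → x * (x ⁻¹) ≈ 1#
    charZero  : ∀ n → ¬ (_×1 commRing (ℕ.suc n) ≈ 0#)

module PowerSeries {c ℓ : Level} (F : CharZeroField c ℓ) where
  open CharZeroField F

  _÷_ : Carrier → Carrier → Carrier
  x ÷ y = x * (y ⁻¹)

  Σ< : ℕ → (ℕ → Carrier) → Carrier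
  Σ< zero f = 0#
  Σ< (ℕ.suc n) f = Σ< n f + f n

  -- a formal power series: coefficient of a^m r^n is  f m n
  PS : Set c
  PS = ℕ → ℕ → Carrier

  _≈ₚ_ : PS → PS → Set ℓ
  f ≈ₚ g = ∀ m n → f m n ≈ g m n

  infix 4 _≈ₚ_
  infixl 6 _+ₚ_ _-ₚ_
  infixl 7 _*ₚ_

  const : Carrier → PS
  const x zero zero = x
  const x _ _ = 0#

  0ₚ 1ₚ : PS
  0ₚ = const 0#
  1ₚ = const 1#

  A : PS
  A (ℕ.suc zero) zero = 1#
  A _ _ = 0#

  R : PS
  R zero (ℕ.suc zero) = 1#
  R _ _ = 0#

  _+ₚ_ _-ₚ_ _*ₚ_ : PS → PS → PS
  (f +ₚ g) m n = f m n + g m n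
  (f -ₚ g) m n = f m n - g m n
  (f *ₚ g) m n = Σ< (ℕ.suc m) λ i → Σ< (ℕ.suc n) λ k → f i k * g (m ∸ i) (n ∸ k)

  _^ₚ_ : PS → ℕ → PS
  f ^ₚ zero = 1ₚ
  f ^ₚ ℕ.suc k = (f ^ₚ k) *ₚ f

  -- multiplicative inverse of a series with nonzero constant term:
  -- writing f = f₀₀ (1 - h) with h of order ≥ 1,  f⁻¹ = f₀₀⁻¹ Σ_k h^k,
  -- and only k ≤ m + n contribute to the coefficient of a^m r^n.
  invₚ : PS → PS
  invₚ f m n = (f 0 0 ⁻¹) * Σ< (ℕ.suc (m ℕ.+ n)) (λ k → (h ^ₚ k) m n)
    where
    h : PS
    h = 1ₚ -ₚ (const (f 0 0 ⁻¹) *ₚ f)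

  -- exact division by r (meaningful when f is divisible by r)
  divR : PS → PS
  divR f m n = f m (ℕ.suc n)

  divR^ : ℕ → PS → PS
  divR^ zero f = f
  divR^ (ℕ.suc k) f = divR (divR^ k f)

  q : PS
  q = 1ₚ -ₚ R

  poch : PS → ℕ → PS
  poch x zero = 1ₚ
  poch x (ℕ.suc k) = poch x k *ₚ (1ₚ -ₚ x *ₚ (q ^ₚ k))

  -- sum of a family of series in which the k-th term has total order ≥ k
  -- (in a and r); the coefficient of a^m r^n only receives k ≤ m + n.
  tsum : (ℕ → PS) → PS
  tsum T m n = Σ< (ℕ.suc (m ℕ.+ n)) (λ k → T k m n)

  -- (q^j;q)_k / (q;q)_k, computed as  [(q^j;q)_k / r^k] · [(q;q)_k / r^k]⁻¹
  -- (both numerator and denominator are divisible by r^k exactly as series).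
  qBinRatio : ℕ → ℕ → PS
  qBinRatio j k = divR^ k (poch (q ^ₚ j) k) *ₚ invₚ (divR^ k (poch q k))

  LHS : Carrier → Carrier → Carrier → Carrier → ℕ → PS
  LHS b c d e j = tsum λ k →
      qBinRatio j k *ₚ poch (1ₚ -ₚ A) k *ₚ poch (const b) k *ₚ poch (const c) k
        *ₚ (q ^ₚ k)
        *ₚ invₚ (poch (const d) k *ₚ poch (const e) k
                   *ₚ poch ((q ^ₚ ℕ.suc j) *ₚ (1ₚ -ₚ A) *ₚ const ((b * c) ÷ (d * e))) k)

  prefactor : Carrier → Carrier → Carrier → Carrier → ℕ → PS
  prefactor b c d e j =
      poch (q *ₚ const (1# ÷ e)) j *ₚ poch (q *ₚ (1ₚ -ₚ A) *ₚ const ((b * c) ÷ (d * e))) j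
        *ₚ invₚ (poch (q *ₚ (1ₚ -ₚ A) *ₚ const (1# ÷ e)) j *ₚ poch (q *ₚ const ((b * c) ÷ (d * e))) j)

  RHS : Carrier → Carrier → Carrier → Carrier → ℕ → PS
  RHS b c d e j = prefactor b c d e j *ₚ (tsum λ k →
      qBinRatio j k *ₚ poch (1ₚ -ₚ A) k *ₚ poch (const (d ÷ b)) k *ₚ poch (const (d ÷ c)) k
        *ₚ (q ^ₚ k)
        *ₚ invₚ (poch (const d) k *ₚ poch (const ((d * e) ÷ (b * c))) k
                   *ₚ poch ((q ^ₚ ℕ.suc j) *ₚ (1ₚ -ₚ A) *ₚ const (1# ÷ e)) k))

-- Modulo terms of total order > N in a and r, the factor (1−a;q)_k vanishes for k > N, so both
-- series become finite sums over a commutative ring, in which (q^j;q)_k / (q;q)_k is a Gaussian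
-- binomial coefficient. There the classical derivation of Sears' transformation goes through:
-- expand (d/b;q)_k (d/c;q)_k / (d;q)_k on the right by the terminating q-Saalschütz sum,
-- interchange the summations, and sum the inner series by a q-Saalschütz sum in which q^j plays
-- the role of q^−n while the series is cut off by (1−a;q)_k. The latter sum satisfies a
-- first-order recurrence in j, obtained by telescoping.
module Submission where

-- Division is the obstacle. Modulo high order, 1 - q = r is nilpotent and numerator factors may be
-- zero divisors. So denominators enter only through sequences of inverses of their factors,
-- summation formulas are stated cross-multiplied, and cancellation is confined to an explicit unit
-- built from q, x = d/(bc) and e. Likewise no q^(-n) is specialised and continued analytically: the
-- factor (1-a;q)_i is carried along on both sides, and it annihilates the boundary term of the
-- telescoping. Truncation is not a quotient: series and operations stay the same, and only equality
-- is weakened to the exponents with m + n ≤ N. Division by r^k shifts coefficients and would lose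
-- precision, so the quotient (q^j;q)_k / (q;q)_k is identified with a Gaussian binomial for full
-- series, before truncating. Each summation then reduces to polynomial identities for the ring
-- solver; relations between the variables, such as the balancing condition, are fed in with
-- explicit cofactors by `modulo`.

open import Defs
open import Level using (Level; _⊔_)
open import Data.Nat using (ℕ)
open import Data.Product using (_×_; _,_; ∃)
open import Relation.Nullary using (¬_; yes; no)
open import Data.Maybe using (just; nothing)
open import Data.Nat as ℕ using (zero; suc; _∸_)
import Data.Nat.Properties as ℕ
open import Data.Unit using (⊤; tt)
open import Function using (_∘_)
open import Relation.Binary.Definitions using (WeaklyDecidable)
open import Relation.Binary.PropositionalEquality as ≡ using (_≡_)
open import Algebra.Bundles using (CommutativeRing; RawRing)
open import Algebra.Solver.Ring.AlmostCommutativeRing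
  using (fromCommutativeRing; _-Raw-AlmostCommutative⟶_; Induced-equivalence)
open import Algebra.Properties.CommutativeSemigroup ℕ.+-commutativeSemigroup
  using () renaming (interchange to ℕ-interchange)
import Algebra.Construct.Pointwise
import Algebra.Properties.AbelianGroup
import Algebra.Properties.CommutativeSemigroup
import Algebra.Properties.Ring
import Algebra.Properties.Semiring.Mult
import Algebra.Solver.Ring
import Relation.Binary.Reasoning.Setoid

-- A ring solver with integer coefficients

-- Coefficients of the solver are formal differences (m , n) of naturals, standing for m − n.
module IntegerSolver {c ℓ : Level} (K : CommutativeRing c ℓ) where
  open CommutativeRing K
  open Algebra.Properties.Ring ring using (-‿distribˡ-*; -‿distribʳ-*)
  open Algebra.Properties.AbelianGroup +-abelianGroup
    using (⁻¹-∙-comm; ⁻¹-anti-homo‿-; ε⁻¹≈ε; ⁻¹-involutive; ∙-cancelʳ)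
  open Algebra.Properties.Semiring.Mult semiring
    using (×-homo-+; ×1-homo-*; ×-homo-1) renaming (_×_ to _·_)
  open Algebra.Properties.CommutativeSemigroup +-commutativeSemigroup using (interchange)
  open Relation.Binary.Reasoning.Setoid setoid

  differences : RawRing _ _
  differences = record
    { Carrier = ℕ × ℕ
    ; _≈_ = _≡_
    ; _+_ = λ (a , b) (c , d) → a ℕ.+ c , b ℕ.+ d
    ; _*_ = λ (a , b) (c , d) → a ℕ.* c ℕ.+ b ℕ.* d , a ℕ.* d ℕ.+ b ℕ.* c
    ; -_ = λ (a , b) → b , a
    ; 0# = 0 , 0
    ; 1# = 1 , 0
    }

  private
    module D = RawRing differences

  value : ℕ × ℕ → Carrier
  value (a , b) = a · 1# - b · 1#

  +-value : ∀ x y → value (x D.+ y) ≈ value x + value y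
  +-value (a , b) (c , d) = begin
    (a ℕ.+ c) · 1# - (b ℕ.+ d) · 1#
      ≈⟨ +-cong (×-homo-+ 1# a c) (-‿cong (×-homo-+ 1# b d)) ⟩
    (a · 1# + c · 1#) - (b · 1# + d · 1#)        ≈⟨ +-congˡ (sym (⁻¹-∙-comm _ _)) ⟩
    (a · 1# + c · 1#) + (- (b · 1#) - d · 1#)    ≈⟨ interchange _ _ _ _ ⟩
    value (a , b) + value (c , d)                ∎

  *-value : ∀ x y → value (x D.* y) ≈ value x * value y
  *-value (a , b) (c , d) = begin
    (a ℕ.* c ℕ.+ b ℕ.* d) · 1# - (a ℕ.* d ℕ.+ b ℕ.* c) · 1#
      ≈⟨ +-cong (×-homo-+ 1# (a ℕ.* c) _) (-‿cong (×-homo-+ 1# (a ℕ.* d) _)) ⟩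
    ((a ℕ.* c) · 1# + (b ℕ.* d) · 1#) - ((a ℕ.* d) · 1# + (b ℕ.* c) · 1#)
      ≈⟨ +-cong (+-cong (×1-homo-* a c) (×1-homo-* b d))
                (-‿cong (+-cong (×1-homo-* a d) (×1-homo-* b c))) ⟩
    (A * C + B * D) - (A * D + B * C)            ≈⟨ +-congˡ (sym (⁻¹-∙-comm _ _)) ⟩
    (A * C + B * D) + (- (A * D) - B * C)        ≈⟨ interchange _ _ _ _ ⟩
    (A * C - A * D) + (B * D - B * C)
      ≈⟨ +-cong (+-congˡ (-‿distribʳ-* A D)) (+-comm _ _) ⟩
    (A * C + A * - D) + (- (B * C) + B * D)
      ≈⟨ +-cong (sym (distribˡ A C (- D))) (+-cong (-‿distribˡ-* B C) B*D) ⟩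
    A * (C - D) + (- B * C + - B * - D)          ≈⟨ +-congˡ (sym (distribˡ (- B) C (- D))) ⟩
    A * (C - D) + - B * (C - D)                  ≈⟨ sym (distribʳ (C - D) A (- B)) ⟩
    (A - B) * (C - D)                            ∎
    where
    A = a · 1#
    B = b · 1#
    C = c · 1#
    D = d · 1#
    B*D : B * D ≈ - B * - D
    B*D = begin
      B * D          ≈⟨ sym (⁻¹-involutive _) ⟩
      - - (B * D)    ≈⟨ -‿cong (-‿distribˡ-* B D) ⟩
      - (- B * D)    ≈⟨ -‿distribʳ-* (- B) D ⟩
      - B * - D      ∎

  -- The separate clauses make the constants 0 and 1 of the solver denote 0# and 1# on the nose.
  ⟦_⟧ᶜ : ℕ × ℕ → Carrier
  ⟦ 0 , 0 ⟧ᶜ = 0#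
  ⟦ 1 , 0 ⟧ᶜ = 1#
  ⟦ x ⟧ᶜ     = value x

  ⟦⟧ᶜ≈value : ∀ x → ⟦ x ⟧ᶜ ≈ value x
  ⟦⟧ᶜ≈value (zero , zero)      = sym (-‿inverseʳ 0#)
  ⟦⟧ᶜ≈value (zero , suc _)     = refl
  ⟦⟧ᶜ≈value (1 , zero)         = sym (trans (+-cong (×-homo-1 1#) ε⁻¹≈ε) (+-identityʳ 1#))
  ⟦⟧ᶜ≈value (1 , suc _)        = refl
  ⟦⟧ᶜ≈value (suc (suc _) , _)  = refl

  differences⟶K : differences -Raw-AlmostCommutative⟶ fromCommutativeRing K
  differences⟶K = record
    { ⟦_⟧ = ⟦_⟧ᶜ
    ; +-homo = λ x y → trans (⟦⟧ᶜ≈value (x D.+ y))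
        (trans (+-value x y) (sym (+-cong (⟦⟧ᶜ≈value x) (⟦⟧ᶜ≈value y))))
    ; *-homo = λ x y → trans (⟦⟧ᶜ≈value (x D.* y))
        (trans (*-value x y) (sym (*-cong (⟦⟧ᶜ≈value x) (⟦⟧ᶜ≈value y))))
    ; -‿homo = λ x@(a , b) → trans (⟦⟧ᶜ≈value (b , a))
        (trans (sym (⁻¹-anti-homo‿- (a · 1#) (b · 1#))) (-‿cong (sym (⟦⟧ᶜ≈value x))))
    ; 0-homo = refl
    ; 1-homo = refl
    }

  -- Equal cross sums give equal values by additive cancellation. Unequal ones refute nothing, since
  -- the characteristic of `K` is arbitrary; hence only weak decidability.
  _value≟_ : WeaklyDecidable (Induced-equivalence differences⟶K)
  (a , b) value≟ (c , d) with a ℕ.+ d ℕ.≟ c ℕ.+ b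
  ... | no _   = nothing
  ... | yes eq = just (trans (⟦⟧ᶜ≈value (a , b)) (trans (∙-cancelʳ (b · 1# + d · 1#) _ _ (begin
    value (a , b) + (b · 1# + d · 1#)    ≈⟨ cancel (a · 1#) (b · 1#) (d · 1#) ⟩
    a · 1# + d · 1#                      ≈⟨ sym (×-homo-+ 1# a d) ⟩
    (a ℕ.+ d) · 1#                       ≡⟨ ≡.cong (_· 1#) eq ⟩
    (c ℕ.+ b) · 1#                       ≈⟨ ×-homo-+ 1# c b ⟩
    c · 1# + b · 1#                      ≈⟨ sym (cancel (c · 1#) (d · 1#) (b · 1#)) ⟩
    value (c , d) + (d · 1# + b · 1#)    ≈⟨ +-congˡ (+-comm _ _) ⟩
    value (c , d) + (b · 1# + d · 1#)    ∎)) (sym (⟦⟧ᶜ≈value (c , d)))))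
    where
    cancel : ∀ x y z → (x - y) + (y + z) ≈ x + z
    cancel x y z = begin
      (x - y) + (y + z)    ≈⟨ sym (+-assoc _ _ _) ⟩
      ((x - y) + y) + z    ≈⟨ +-congʳ (+-assoc _ _ _) ⟩
      (x + (- y + y)) + z  ≈⟨ +-congʳ (+-congˡ (-‿inverseˡ y)) ⟩
      (x + 0#) + z         ≈⟨ +-congʳ (+-identityʳ x) ⟩
      x + z                ∎

  open Algebra.Solver.Ring differences (fromCommutativeRing K) differences⟶K _value≟_ public
    using (solve; _:=_; _:+_; _:*_; _:-_; :-_; con; Polynomial)

  :0 :1 : ∀ {n} → Polynomial n
  :0 = con (0 , 0)
  :1 = con (1 , 0)

-- Finite sums and products in a commutative ring

module SumsAndProducts {c ℓ : Level} (K : CommutativeRing c ℓ) where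
  open CommutativeRing K
  open IntegerSolver K
  open Algebra.Properties.AbelianGroup +-abelianGroup using (x∙y⁻¹≈ε⇒x≈y; x≈y⇒x∙y⁻¹≈ε)
  open Relation.Binary.Reasoning.Setoid setoid

  Σ< Π< : ℕ → (ℕ → Carrier) → Carrier
  Σ< zero f = 0#
  Σ< (suc n) f = Σ< n f + f n
  Π< zero f = 1#
  Π< (suc n) f = Π< n f * f n

  infixr 8 _^_
  -- As a product, a power inherits the splitting lemmas for `Π<`; the new factor stands on the
  -- right, as in `_^ₚ_`.
  _^_ : Carrier → ℕ → Carrier
  x ^ n = Π< n (λ _ → x)

  Unit : Carrier → Set (c ⊔ ℓ)
  Unit x = ∃ λ y → y * x ≈ 1#

  Σ-cong< : ∀ n {f g} → (∀ i → i ℕ.< n → f i ≈ g i) → Σ< n f ≈ Σ< n g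
  Σ-cong< zero    f≈g = refl
  Σ-cong< (suc n) f≈g =
    +-cong (Σ-cong< n (λ i i<n → f≈g i (ℕ.m≤n⇒m≤1+n i<n))) (f≈g n ℕ.≤-refl)

  Σ-cong : ∀ n {f g} → (∀ i → f i ≈ g i) → Σ< n f ≈ Σ< n g
  Σ-cong n f≈g = Σ-cong< n (λ i _ → f≈g i)

  Σ-zero : ∀ n → Σ< n (λ _ → 0#) ≈ 0#
  Σ-zero zero    = refl
  Σ-zero (suc n) = trans (+-identityʳ _) (Σ-zero n)

  Σ-+ : ∀ n f g → Σ< n (λ i → f i + g i) ≈ Σ< n f + Σ< n g
  Σ-+ zero    f g = sym (+-identityˡ 0#)
  Σ-+ (suc n) f g = trans (+-congʳ (Σ-+ n f g))
    (solve 4 (λ a b x y → (a :+ b) :+ (x :+ y) := (a :+ x) :+ (b :+ y)) refl _ _ _ _)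

  Σ-*ˡ : ∀ n x f → x * Σ< n f ≈ Σ< n (λ i → x * f i)
  Σ-*ˡ zero    x f = zeroʳ x
  Σ-*ˡ (suc n) x f = trans (distribˡ x _ _) (+-congʳ (Σ-*ˡ n x f))

  Σ-suc : ∀ n f → Σ< (suc n) f ≈ f 0 + Σ< n (f ∘ suc)
  Σ-suc zero    f = +-comm 0# (f 0)
  Σ-suc (suc n) f = trans (+-congʳ (Σ-suc n f)) (+-assoc _ _ _)

  Π-cong : ∀ n {f g} → (∀ i → f i ≈ g i) → Π< n f ≈ Π< n g
  Π-cong zero    f≈g = refl
  Π-cong (suc n) f≈g = *-cong (Π-cong n f≈g) (f≈g n)

  Π-* : ∀ n f g → Π< n (λ i → f i * g i) ≈ Π< n f * Π< n g
  Π-* zero    f g = sym (*-identityˡ 1#)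
  Π-* (suc n) f g = trans (*-congʳ (Π-* n f g))
    (solve 4 (λ a b x y → (a :* b) :* (x :* y) := (a :* x) :* (b :* y)) refl _ _ _ _)

  Π-one : ∀ n → Π< n (λ _ → 1#) ≈ 1#
  Π-one zero    = refl
  Π-one (suc n) = trans (*-identityʳ _) (Π-one n)

  Π-suc : ∀ n f → Π< (suc n) f ≈ f 0 * Π< n (f ∘ suc)
  Π-suc zero    f = *-comm 1# (f 0)
  Π-suc (suc n) f = trans (*-congʳ (Π-suc n f)) (*-assoc _ _ _)

  Π-split : ∀ i m f → Π< (i ℕ.+ m) f ≈ Π< i f * Π< m (λ s → f (i ℕ.+ s))
  Π-split zero    m f = sym (*-identityˡ _)
  Π-split (suc i) m f = begin
    Π< (suc (i ℕ.+ m)) f                                        ≈⟨ Π-suc (i ℕ.+ m) f ⟩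
    f 0 * Π< (i ℕ.+ m) (f ∘ suc)                                ≈⟨ *-congˡ (Π-split i m (f ∘ suc)) ⟩
    f 0 * (Π< i (f ∘ suc) * Π< m (λ s → f (suc i ℕ.+ s)))       ≈⟨ sym (*-assoc _ _ _) ⟩
    f 0 * Π< i (f ∘ suc) * Π< m (λ s → f (suc i ℕ.+ s))         ≈⟨ *-congʳ (sym (Π-suc i f)) ⟩
    Π< (suc i) f * Π< m (λ s → f (suc i ℕ.+ s))                 ∎

  Π-inverse : ∀ n f g → (∀ i → f i * g i ≈ 1#) → Π< n f * Π< n g ≈ 1#
  Π-inverse n f g fg≈1 = trans (sym (Π-* n f g)) (trans (Π-cong n fg≈1) (Π-one n))

  *-unit : ∀ {x y} → Unit x → Unit y → Unit (x * y)
  *-unit {x} {y} (x′ , x′x≈1) (y′ , y′y≈1) = x′ * y′ , (begin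
    x′ * y′ * (x * y)
      ≈⟨ solve 4 (λ x y x′ y′ → x′ :* y′ :* (x :* y) := x′ :* x :* (y′ :* y)) refl x y x′ y′ ⟩
    x′ * x * (y′ * y)    ≈⟨ *-cong x′x≈1 y′y≈1 ⟩
    1# * 1#              ≈⟨ *-identityˡ 1# ⟩
    1#                   ∎)

  ^-unit : ∀ {x} n → Unit x → Unit (x ^ n)
  ^-unit n (x′ , x′x≈1) = x′ ^ n , Π-inverse n _ _ (λ _ → x′x≈1)

  unit-cancel : ∀ {u x y} → Unit u → u * x ≈ u * y → x ≈ y
  unit-cancel {u} {x} {y} (u′ , u′u≈1) ux≈uy = begin
    x              ≈⟨ insert x ⟩
    u′ * (u * x)   ≈⟨ *-congˡ ux≈uy ⟩
    u′ * (u * y)   ≈⟨ sym (insert y) ⟩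
    y              ∎
    where
    insert : ∀ z → z ≈ u′ * (u * z)
    insert z = trans (sym (*-identityˡ z)) (trans (*-congʳ (sym u′u≈1)) (*-assoc _ _ _))

  1-‿cong : ∀ {x y} → x ≈ y → 1# - x ≈ 1# - y
  1-‿cong x≈y = +-congˡ (-‿cong x≈y)

  -- Rewriting by p ≈ p′ inside a polynomial identity, with cofactor e.
  modulo : ∀ {x y p p′} e → p ≈ p′ → x ≈ y + e * (p - p′) → x ≈ y
  modulo {x} {y} {p} {p′} e p≈p′ x≈ = begin
    x                   ≈⟨ x≈ ⟩
    y + e * (p - p′)    ≈⟨ +-congˡ (trans (*-congˡ (x≈y⇒x∙y⁻¹≈ε p≈p′)) (zeroʳ e)) ⟩
    y + 0#              ≈⟨ +-identityʳ y ⟩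
    y                   ∎

  times-one : ∀ {u} x → u ≈ 1# → x ≈ x * u
  times-one x u≈1 = trans (sym (*-identityʳ x)) (*-congˡ (sym u≈1))

  -- Serves both the inversion of a series 1 - h and the extraction of the factor 1 - q from 1 -
  -- q^(m+1).
  geometric : ∀ n x → (1# - x) * Σ< n (x ^_) ≈ 1# - x ^ n
  geometric zero    x = trans (zeroʳ _) (sym (-‿inverseʳ 1#))
  geometric (suc n) x = begin
    (1# - x) * (Σ< n (x ^_) + x ^ n)                ≈⟨ distribˡ _ _ _ ⟩
    (1# - x) * Σ< n (x ^_) + (1# - x) * x ^ n       ≈⟨ +-congʳ (geometric n x) ⟩
    1# - x ^ n + (1# - x) * x ^ n
      ≈⟨ solve 2 (λ x y → :1 :- y :+ (:1 :- x) :* y := :1 :- y :* x) refl x (x ^ n) ⟩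
    1# - x ^ n * x                                  ∎

  -- The sum over the antidiagonal i + m = k.
  Σ∕ : ℕ → (ℕ → ℕ → Carrier) → Carrier
  Σ∕ k F = Σ< (suc k) (λ i → F i (k ∸ i))

  Σ∕-suc : ∀ k F → Σ∕ (suc k) F ≈ F 0 (suc k) + Σ∕ k (F ∘ suc)
  Σ∕-suc k F = Σ-suc (suc k) _

  -- The condition is an equation i + m ≡ k rather than a subtraction, so that proofs can match on
  -- it and then split powers and products at i.
  Σ∕-cong : ∀ k F F′ → (∀ i m → i ℕ.+ m ≡ k → F i m ≈ F′ i m) → Σ∕ k F ≈ Σ∕ k F′
  Σ∕-cong k F F′ F≈F′ = Σ-cong< (suc k) (λ i i<1+k → F≈F′ i (k ∸ i) (ℕ.m+[n∸m]≡n (ℕ.≤-pred i<1+k)))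

  Σ∕-head : ∀ k F → (∀ i m → F (suc i) m ≈ 0#) → Σ∕ k F ≈ F 0 k
  Σ∕-head zero    F F≈0 = +-identityˡ _
  Σ∕-head (suc k) F F≈0 = trans (Σ∕-suc k F) (trans
    (+-congˡ (trans (Σ-cong (suc k) (λ i → F≈0 i (k ∸ i))) (Σ-zero (suc k)))) (+-identityʳ _))

  Σ∕-*ˡ : ∀ k x F → x * Σ∕ k F ≈ Σ∕ k (λ i m → x * F i m)
  Σ∕-*ˡ k x F = Σ-*ˡ (suc k) x _

  Σ∕-+ : ∀ k F F′ → Σ∕ k (λ i m → F i m + F′ i m) ≈ Σ∕ k F + Σ∕ k F′
  Σ∕-+ k F F′ = Σ-+ (suc k) _ _

  -- Splitting the entry i = 0 off every antidiagonal collects the row `F 0`; what remains is the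
  -- same triangle for `F ∘ suc`.
  Σ-triangle : ∀ n F → Σ< n (λ k → Σ∕ k F) ≈ Σ< n (λ i → Σ< (n ∸ i) (F i))
  Σ-triangle zero    F = refl
  Σ-triangle (suc n) F = begin
    Σ< (suc n) (λ k → Σ∕ k F)                                   ≈⟨ Σ-suc n _ ⟩
    Σ∕ 0 F + Σ< n (λ k → Σ∕ (suc k) F)
      ≈⟨ +-cong (+-identityˡ _) (Σ-cong n (λ k → Σ∕-suc k F)) ⟩
    F 0 0 + Σ< n (λ k → F 0 (suc k) + Σ∕ k (F ∘ suc))           ≈⟨ +-congˡ (Σ-+ n _ _) ⟩
    F 0 0 + (Σ< n (F 0 ∘ suc) + Σ< n (λ k → Σ∕ k (F ∘ suc)))    ≈⟨ sym (+-assoc _ _ _) ⟩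
    F 0 0 + Σ< n (F 0 ∘ suc) + Σ< n (λ k → Σ∕ k (F ∘ suc))
      ≈⟨ +-cong (sym (Σ-suc n (F 0))) (Σ-triangle n (F ∘ suc)) ⟩
    Σ< (suc n) (F 0) + Σ< n (λ i → Σ< (n ∸ i) (F (suc i)))      ≈⟨ sym (Σ-suc n _) ⟩
    Σ< (suc n) (λ i → Σ< (suc n ∸ i) (F i))                     ∎

  -- If Y on the antidiagonal k + 1 is obtained by moving the part U of each entry of the
  -- antidiagonal k one step in the m direction and the part V one step in the i direction,
  -- then the sums agree.
  Σ∕-shift : ∀ k (Y U V : ℕ → ℕ → Carrier) →
    (∀ i → Y (suc i) 0 ≈ V i 0) →
    (∀ i m → Y (suc i) (suc m) ≈ U (suc i) m + V i (suc m)) →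
    U 0 k + Σ∕ k (Y ∘ suc) ≈ Σ∕ k U + Σ∕ k V
  Σ∕-shift zero Y U V Y₀ Y₊ = begin
    U 0 0 + (0# + Y 1 0)         ≈⟨ +-congˡ (+-congˡ (Y₀ 0)) ⟩
    U 0 0 + (0# + V 0 0)         ≈⟨ +-congʳ (sym (+-identityˡ _)) ⟩
    0# + U 0 0 + (0# + V 0 0)    ∎
  Σ∕-shift (suc k) Y U V Y₀ Y₊ = begin
    U 0 (suc k) + Σ∕ (suc k) (Y ∘ suc)
      ≈⟨ +-congˡ (trans (Σ∕-suc k (Y ∘ suc)) (+-congʳ (Y₊ 0 k))) ⟩
    U 0 (suc k) + (U 1 k + V 0 (suc k) + Σ∕ k (Y ∘ suc ∘ suc))
      ≈⟨ solve 4 (λ a b c d → a :+ (b :+ c :+ d) := a :+ c :+ (b :+ d)) refl _ _ _ _ ⟩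
    U 0 (suc k) + V 0 (suc k) + (U 1 k + Σ∕ k (Y ∘ suc ∘ suc))
      ≈⟨ +-congˡ (Σ∕-shift k (Y ∘ suc) (U ∘ suc) (V ∘ suc) (Y₀ ∘ suc) (Y₊ ∘ suc)) ⟩
    U 0 (suc k) + V 0 (suc k) + (Σ∕ k (U ∘ suc) + Σ∕ k (V ∘ suc))
      ≈⟨ solve 4 (λ a b c d → a :+ c :+ (b :+ d) := a :+ b :+ (c :+ d)) refl _ _ _ _ ⟩
    U 0 (suc k) + Σ∕ k (U ∘ suc) + (V 0 (suc k) + Σ∕ k (V ∘ suc))
      ≈⟨ +-cong (sym (Σ∕-suc k U)) (sym (Σ∕-suc k V)) ⟩
    Σ∕ (suc k) U + Σ∕ (suc k) V  ∎

-- Shifted factorials and Gaussian binomials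

module QSeries {c ℓ : Level} (K : CommutativeRing c ℓ) (q : CommutativeRing.Carrier K) where
  open CommutativeRing K
  open IntegerSolver K
  open SumsAndProducts K
  open Relation.Binary.Reasoning.Setoid setoid

  poch : Carrier → ℕ → Carrier
  poch x k = Π< k (λ m → 1# - x * q ^ m)

  poch-split : ∀ x i m → poch x (i ℕ.+ m) ≈ poch x i * poch (x * q ^ i) m
  poch-split x i m = trans (Π-split i m _) (*-congˡ (Π-cong m (λ s →
    1-‿cong (trans (*-congˡ (Π-split i s _)) (sym (*-assoc _ _ _))))))

  poch-cong : ∀ {x y} → x ≈ y → ∀ k → poch x k ≈ poch y k
  poch-cong x≈y k = Π-cong k (λ m → 1-‿cong (*-congʳ x≈y))

  -- The Gaussian binomial coefficient [j+k−1 choose k], i.e. (q^j;q)_k / (q;q)_k.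
  gauss : ℕ → ℕ → Carrier
  gauss j       zero    = 1#
  gauss zero    (suc k) = 0#
  gauss (suc j) (suc k) = gauss j (suc k) + q ^ j * gauss (suc j) k

  mutual
    -- Neither contiguity relation follows from the other by division, as 1 - q^j may be a zero
    -- divisor. They are proved together: the Pascal step for `gauss-upper` at (j, k+1) and the one
    -- for `gauss-lower` at (j+1, k) each need both relations at (j, k).
    gauss-upper : ∀ j k → (1# - q ^ j) * gauss (suc j) k ≈ (1# - q ^ j * q ^ k) * gauss j k
    gauss-upper j zero = *-congʳ (1-‿cong (sym (*-identityʳ _)))
    gauss-upper j (suc k) = begin
      (1# - u) * (g + u * g′)
        ≈⟨ solve 3 (λ u g g′ → (:1 :- u) :* (g :+ u :* g′) := (:1 :- u) :* g :+ u :* ((:1 :- u) :* g′))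
             refl u g g′ ⟩
      (1# - u) * g + u * ((1# - u) * g′)
        ≈⟨ +-congˡ (*-congˡ (gauss-ratio j k)) ⟩
      (1# - u) * g + u * ((1# - q ^ k * q) * g)
        ≈⟨ solve 4 (λ q u v g → (:1 :- u) :* g :+ u :* ((:1 :- v :* q) :* g)
                       := (:1 :- u :* (v :* q)) :* g) refl q u (q ^ k) g ⟩
      (1# - u * (q ^ k * q)) * g   ∎
      where
      u = q ^ j
      g = gauss j (suc k)
      g′ = gauss (suc j) k

    gauss-lower : ∀ j k → (1# - q ^ suc k) * gauss j (suc k) ≈ (1# - q ^ j * q ^ k) * gauss j k
    gauss-lower zero zero = solve 1 (λ q → (:1 :- :1 :* q) :* :0 := (:1 :- :1 :* :1) :* :1) refl q
    gauss-lower zero (suc k) = trans (zeroʳ _) (sym (zeroʳ _))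
    gauss-lower (suc j) k = begin
      (1# - v * q) * (g + u * g′)
        ≈⟨ distribˡ _ g (u * g′) ⟩
      (1# - v * q) * g + (1# - v * q) * (u * g′)
        ≈⟨ +-congʳ (trans (gauss-lower j k) (sym (gauss-upper j k))) ⟩
      (1# - u) * g′ + (1# - v * q) * (u * g′)
        ≈⟨ solve 4 (λ q u v g → (:1 :- u) :* g :+ (:1 :- v :* q) :* (u :* g)
                       := (:1 :- u :* q :* v) :* g) refl q u v g′ ⟩
      (1# - u * q * v) * g′        ∎
      where
      u = q ^ j
      v = q ^ k
      g = gauss j (suc k)
      g′ = gauss (suc j) k

    gauss-ratio : ∀ j k → (1# - q ^ j) * gauss (suc j) k ≈ (1# - q ^ suc k) * gauss j (suc k)
    gauss-ratio j k = trans (gauss-upper j k) (sym (gauss-lower j k))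

  -- Cross-multiplied because (q;q)_k need not be invertible; `gauss-lower` is exactly the passage
  -- from k to k+1.
  gauss-poch : ∀ j k → poch (q ^ j) k ≈ gauss j k * poch q k
  gauss-poch j zero    = sym (*-identityˡ 1#)
  gauss-poch j (suc k) = begin
    poch (q ^ j) k * (1# - q ^ j * q ^ k)          ≈⟨ *-congʳ (gauss-poch j k) ⟩
    gauss j k * poch q k * (1# - q ^ j * q ^ k)
      ≈⟨ solve 3 (λ a b c → a :* b :* c := c :* a :* b) refl _ _ _ ⟩
    (1# - q ^ j * q ^ k) * gauss j k * poch q k    ≈⟨ *-congʳ (sym (gauss-lower j k)) ⟩
    (1# - q ^ k * q) * gauss j (suc k) * poch q k
      ≈⟨ solve 4 (λ q v a b → (:1 :- v :* q) :* a :* b := a :* (b :* (:1 :- q :* v)))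
           refl q (q ^ k) _ _ ⟩
    gauss j (suc k) * (poch q k * (1# - q * q ^ k)) ∎

  gauss-1 : ∀ k → gauss 1 k ≈ 1#
  gauss-1 zero    = refl
  gauss-1 (suc k) = trans (+-identityˡ _) (trans (*-identityˡ _) (gauss-1 k))

  -- Both sides satisfy the Pascal recurrence of the Gaussian trinomial coefficients.
  gauss-trinomial : ∀ j i m →
    gauss j (i ℕ.+ m) * gauss (suc i) m ≈ gauss j i * gauss (i ℕ.+ j) m
  gauss-trinomial j i zero =
    *-congʳ (reflexive (≡.cong (gauss j) (ℕ.+-identityʳ i)))
  gauss-trinomial j zero (suc m) =
    trans (*-congˡ (gauss-1 (suc m))) (*-comm _ _)
  gauss-trinomial zero (suc i) (suc m) = trans (zeroˡ _) (sym (zeroˡ _))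
  gauss-trinomial (suc j) (suc i) (suc m) = begin
    (g₁ + u * g₂) * (g₃ + w * q * g₄)
      ≈⟨ solve 7 (λ q u w g₁ g₂ g₃ g₄ →
           (g₁ :+ u :* g₂) :* (g₃ :+ w :* q :* g₄)
             := g₁ :* (g₃ :+ w :* q :* g₄) :+ u :* (g₂ :* g₃) :+ u :* w :* q :* (g₂ :* g₄))
           refl q u w g₁ g₂ g₃ g₄ ⟩
    g₁ * (g₃ + w * q * g₄) + u * (g₂ * g₃) + u * w * q * (g₂ * g₄)
      ≈⟨ +-cong (+-cong (gauss-trinomial j (suc i) (suc m))
           (*-congˡ (gauss-trinomial (suc j) i (suc m))))
           (*-congˡ (trans (*-congʳ (reflexive (≡.cong (gauss (suc j)) (ℕ.+-suc i m))))
             (gauss-trinomial (suc j) (suc i) m))) ⟩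
    h₁ * gauss (suc i ℕ.+ j) (suc m) + u * (h₂ * h₃) + u * w * q * ((h₁ + u * h₂) * h₄)
      ≈⟨ +-congʳ (+-congʳ (*-congˡ (reflexive
           (≡.cong (λ k → gauss k (suc m)) (≡.sym (ℕ.+-suc i j)))))) ⟩
    h₁ * h₃ + u * (h₂ * h₃) + u * w * q * ((h₁ + u * h₂) * h₄)
      ≈⟨ solve 7 (λ q u w h₁ h₂ h₃ h₄ →
           h₁ :* h₃ :+ u :* (h₂ :* h₃) :+ u :* w :* q :* ((h₁ :+ u :* h₂) :* h₄)
             := (h₁ :+ u :* h₂) :* (h₃ :+ w :* (u :* q) :* h₄))
           refl q u w h₁ h₂ h₃ h₄ ⟩
    (h₁ + u * h₂) * (h₃ + w * (u * q) * h₄)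
      ≈⟨ *-congˡ (+-congˡ (*-congʳ (sym (Π-split i (suc j) _)))) ⟩
    (h₁ + u * h₂) * (h₃ + q ^ (i ℕ.+ suc j) * h₄)  ∎
    where
    u = q ^ j
    w = q ^ i
    g₁ = gauss j (suc i ℕ.+ suc m)
    g₂ = gauss (suc j) (i ℕ.+ suc m)
    g₃ = gauss (suc i) (suc m)
    g₄ = gauss (suc (suc i)) m
    h₁ = gauss j (suc i)
    h₂ = gauss (suc j) i
    h₃ = gauss (i ℕ.+ suc j) (suc m)
    h₄ = gauss (suc (i ℕ.+ suc j)) m

-- Two forms of the q-Saalschütz sum

module Summations {c ℓ : Level} (K : CommutativeRing c ℓ) (q : CommutativeRing.Carrier K) where
  open CommutativeRing K
  open IntegerSolver K
  open SumsAndProducts K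
  open QSeries K q
  open Relation.Binary.Reasoning.Setoid setoid

  -- This is the sum of 3φ2(q^(-k), b, c; d, q^(1-k) bc/d; q, q) with d = xbc, multiplied by
  -- (x;q)_k. That multiplication absorbs all negative powers of q: the quotient of the two
  -- k-dependent factorials becomes the binomial `gauss (suc i) m` times (x;q)_m x^i, where i + m =
  -- k.
  module Terminating (x b c : Carrier) (vd : ℕ → Carrier)
                     (vd-inverse : ∀ m → vd m * (1# - x * b * c * q ^ m) ≈ 1#) where

    F : ℕ → ℕ → Carrier
    F i m = gauss (suc i) m * poch x m * x ^ i * poch b i * poch c i * Π< i vd

    ratio : Carrier → Carrier
    ratio w = (1# - x * c * w) * (1# - x * b * w)

    private
      -- With w = q^(i+m), (1 - xcw)(1 - xbw) = (1 - x q^m)(1 - xbc q^(2i+m)) + x q^m (1 - b q^i)(1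
      -- - c q^i). The last product raises i and gives `V`; the first one raises m and gives `U`.
      U V Y : ℕ → ℕ → Carrier
      V i m = q ^ m * gauss (suc i) m * poch x m * x ^ suc i * poch b (suc i) * poch c (suc i) * Π< i vd
      U i m = ratio (q ^ i * q ^ m) * F i m - V i m
      Y zero    m = 0#
      Y (suc i) m = (1# - x * b * c * (q ^ i * q ^ m)) * F (suc i) m

      Y-left : ∀ i → Y (suc i) 0 ≈ V i 0
      Y-left i = trans
        (solve 9 (λ x b c w X B C D e →
           (:1 :- x :* b :* c :* (w :* :1))
               :* (:1 :* :1 :* (X :* x) :* (B :* (:1 :- b :* w)) :* (C :* (:1 :- c :* w)) :* (D :* e))
             := :1 :* :1 :* :1 :* (X :* x) :* (B :* (:1 :- b :* w)) :* (C :* (:1 :- c :* w)) :* D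
                  :* (e :* (:1 :- x :* b :* c :* w)))
           refl x b c (q ^ i) (x ^ i) (poch b i) (poch c i) (Π< i vd) (vd i))
        (sym (times-one _ (vd-inverse i)))

      -- Pascal's rule splits the binomial of the new entry into its two neighbours; the discrepancy
      -- from `U` and `V` is a multiple of the relation `gauss-ratio` between these neighbours.
      Y-inner : ∀ i m → Y (suc i) (suc m) ≈ U (suc i) m + V i (suc m)
      Y-inner i m = trans
        (modulo
          (- ((1# - x * q ^ m)
              * (poch x m * x ^ suc i * poch b (suc i) * poch c (suc i) * Π< (suc i) vd)))
          (gauss-ratio (suc i) m)
          (solve 14 (λ q x b c w v X P B C D e g₀ g₁ →
            (:1 :- x :* b :* c :* (w :* (v :* q)))
                :* ((g₀ :+ w :* q :* g₁) :* (P :* (:1 :- x :* v)) :* (X :* x) :* B :* C :* (D :* e))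
              := ((:1 :- x :* c :* (w :* q :* v)) :* (:1 :- x :* b :* (w :* q :* v))
                    :* (g₁ :* P :* (X :* x) :* B :* C :* (D :* e))
                  :- v :* g₁ :* P :* (X :* x :* x) :* (B :* (:1 :- b :* (w :* q)))
                       :* (C :* (:1 :- c :* (w :* q))) :* (D :* e))
                 :+ v :* q :* g₀ :* (P :* (:1 :- x :* v)) :* (X :* x) :* B :* C :* D
                      :* (e :* (:1 :- x :* b :* c :* w))
                 :+ :- ((:1 :- x :* v) :* (P :* (X :* x) :* B :* C :* (D :* e)))
                      :* ((:1 :- w :* q) :* g₁ :- (:1 :- v :* q) :* g₀))
            refl q x b c (q ^ i) (q ^ m) (x ^ i) (poch x m) (poch b (suc i)) (poch c (suc i))
            (Π< i vd) (vd i) (gauss (suc i) (suc m)) (gauss (suc (suc i)) m)))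
        (+-congˡ (sym (times-one _ (vd-inverse i))))

      Y-right : ∀ k → (1# - x * b * c * q ^ k) * F 0 (suc k) ≈ U 0 k
      Y-right k =
        solve 6 (λ x b c v P g →
          (:1 :- x :* b :* c :* v)
              :* ((:0 :+ :1 :* g) :* (P :* (:1 :- x :* v)) :* :1 :* :1 :* :1 :* :1)
            := (:1 :- x :* c :* (:1 :* v)) :* (:1 :- x :* b :* (:1 :* v))
                  :* (g :* P :* :1 :* :1 :* :1 :* :1)
               :- v :* g :* P :* (:1 :* x) :* (:1 :* (:1 :- b :* :1)) :* (:1 :* (:1 :- c :* :1)) :* :1)
          refl x b c (q ^ k) (poch x k) (gauss 1 k)

      pow-split : ∀ {k} i m → i ℕ.+ m ≡ k → q ^ i * q ^ m ≈ q ^ k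
      pow-split i m ≡.refl = sym (Π-split i m _)

    recurrence : ∀ k → (1# - x * b * c * q ^ k) * Σ∕ (suc k) F ≈ ratio (q ^ k) * Σ∕ k F
    recurrence k = begin
      e * Σ∕ (suc k) F                             ≈⟨ *-congˡ (Σ∕-suc k F) ⟩
      e * (F 0 (suc k) + Σ∕ k (F ∘ suc))           ≈⟨ distribˡ _ _ _ ⟩
      e * F 0 (suc k) + e * Σ∕ k (F ∘ suc)
        ≈⟨ +-cong (Y-right k) (trans (Σ∕-*ˡ k e (F ∘ suc)) (Σ∕-cong k _ (Y ∘ suc) (λ i m i+m≡k →
             *-congʳ (1-‿cong (*-congˡ (sym (pow-split i m i+m≡k))))))) ⟩
      U 0 k + Σ∕ k (Y ∘ suc)                       ≈⟨ Σ∕-shift k Y U V Y-left Y-inner ⟩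
      Σ∕ k U + Σ∕ k V                              ≈⟨ sym (Σ∕-+ k U V) ⟩
      Σ∕ k (λ i m → U i m + V i m)
        ≈⟨ Σ∕-cong k _ (λ i m → ratio (q ^ k) * F i m) (λ i m i+m≡k → trans
             (solve 2 (λ a b → a :- b :+ b := a) refl _ (V i m))
             (*-congʳ (*-cong (1-‿cong (*-congˡ (pow-split i m i+m≡k)))
                              (1-‿cong (*-congˡ (pow-split i m i+m≡k)))))) ⟩
      Σ∕ k (λ i m → ratio (q ^ k) * F i m)         ≈⟨ sym (Σ∕-*ˡ k _ F) ⟩
      ratio (q ^ k) * Σ∕ k F                       ∎
      where
      e = 1# - x * b * c * q ^ k

    summation : ∀ k → poch (x * c) k * poch (x * b) k * Π< k vd ≈ Σ∕ k F
    summation zero = solve 0 (:1 :* :1 :* :1 := :0 :+ :1 :* :1 :* :1 :* :1 :* :1 :* :1) refl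
    summation (suc k) = begin
      poch (x * c) k * (1# - x * c * q ^ k) * (poch (x * b) k * (1# - x * b * q ^ k)) * (Π< k vd * vd k)
        ≈⟨ solve 6 (λ a b c d e f → a :* b :* (c :* d) :* (e :* f) := f :* (b :* d :* (a :* c :* e)))
             refl _ _ _ _ _ _ ⟩
      vd k * (ratio (q ^ k) * (poch (x * c) k * poch (x * b) k * Π< k vd))
        ≈⟨ *-congˡ (*-congˡ (summation k)) ⟩
      vd k * (ratio (q ^ k) * Σ∕ k F)                        ≈⟨ *-congˡ (sym (recurrence k)) ⟩
      vd k * ((1# - x * b * c * q ^ k) * Σ∕ (suc k) F)       ≈⟨ sym (*-assoc _ _ _) ⟩
      vd k * (1# - x * b * c * q ^ k) * Σ∕ (suc k) F         ≈⟨ *-congʳ (vd-inverse k) ⟩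
      1# * Σ∕ (suc k) F                                      ≈⟨ *-identityˡ _ ⟩
      Σ∕ (suc k) F                                           ∎

  module Saalschütz (α b c f : Carrier) (vc vf : ℕ → Carrier)
                    (vc-inverse : ∀ m → vc m * (1# - c * q ^ m) ≈ 1#)
                    (vf-inverse : ∀ m → vf m * (1# - f * q ^ m) ≈ 1#)
                    (balanced : c * f ≈ q * α * b) where

    -- The k-th term of 3φ2(q^J, α, b; c, f q^J; q, q). It is balanced for every J, since q^J occurs
    -- on both sides of the balancing condition.
    term : ℕ → ℕ → Carrier
    term J k = gauss J k * poch α k * poch b k * q ^ k * Π< k vc * Π< k (λ m → vf (J ℕ.+ m))

    private
      lhs rhs : ℕ → Carrier
      lhs s = (c - q * q ^ s * α) * (c - q * q ^ s * b)
      rhs s = (c - q * q ^ s) * (c - q * q ^ s * α * b)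

      -- The certificate of creative telescoping for the recurrence `lhs J` · S(J+1) = `rhs J` ·
      -- S(J). Its factor `poch α n` is what allows z to remove the boundary term.
      H : ℕ → ℕ → Carrier
      H J zero    = 0#
      H J (suc n) = q * q ^ J * c * gauss (suc J) n * poch α (suc n) * poch b (suc n)
                      * Π< n vc * Π< n (λ m → vf (suc J ℕ.+ m))

      step : ∀ J n → lhs J * term (suc J) n ≈ rhs J * term J n + (H J (suc n) - H J n)
      step J zero =
        solve 5 (λ q u α b c →
          (c :- q :* u :* α) :* (c :- q :* u :* b) :* (:1 :* :1 :* :1 :* :1 :* :1 :* :1)
            := (c :- q :* u) :* (c :- q :* u :* α :* b) :* (:1 :* :1 :* :1 :* :1 :* :1 :* :1)
               :+ (q :* u :* c :* :1 :* (:1 :* (:1 :- α :* :1)) :* (:1 :* (:1 :- b :* :1))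
                    :* :1 :* :1 :- :0))
          refl q (q ^ J) α b c
      step J (suc n) = begin
        lhs J * ((X + u * Y) * P * Q * (v * q) * (C * i) * (W * z))
          ≈⟨ modulo (M * (q * u * (c - q * u * α * b * (v * q)))) (gauss-ratio J n)
               (modulo (M * (u * (v * q) * ((c - q * u) * X * (v * q) - q * u * Y * (1# - c * v))))
                 balanced
                 (solve 15 (λ q u v α b c f X Y P Q C i W z →
                   (c :- q :* u :* α) :* (c :- q :* u :* b)
                       :* ((X :+ u :* Y) :* P :* Q :* (v :* q) :* (C :* i) :* (W :* z))
                     := (c :- q :* u) :* c :* (X :* P :* Q :* (v :* q) :* (C :* i) :* W)
                            :* (z :* (:1 :- f :* (u :* q :* v)))
                        :+ (q :* u :* c :* (X :+ u :* Y) :* (P :* (:1 :- α :* (v :* q)))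
                              :* (Q :* (:1 :- b :* (v :* q))) :* (C :* i) :* (W :* z)
                            :- q :* u :* c :* Y :* P :* Q :* C :* W :* (i :* (:1 :- c :* v)
                                 :* (z :* (:1 :- f :* (u :* q :* v)))))
                        :+ P :* Q :* C :* i :* W :* z :* (q :* u :* (c :- q :* u :* α :* b :* (v :* q)))
                             :* ((:1 :- u) :* Y :- (:1 :- v :* q) :* X)
                        :+ P :* Q :* C :* i :* W :* z
                             :* (u :* (v :* q)
                                  :* ((c :- q :* u) :* X :* (v :* q) :- q :* u :* Y :* (:1 :- c :* v)))
                             :* (c :* f :- q :* α :* b))
                   refl q u v α b c f X Y P Q C i W z)) ⟩
        (c - q * u) * c * (X * P * Q * (v * q) * (C * i) * W) * (z * (1# - f * (u * q * v)))
          + (H J (suc (suc n))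
              - q * u * c * Y * P * Q * C * W * (i * (1# - c * v) * (z * (1# - f * (u * q * v)))))
          ≈⟨ +-cong (sym (times-one _ z-inverse)) (+-congˡ (-‿cong (sym (times-one _
               (trans (*-cong (vc-inverse n) z-inverse) (*-identityˡ 1#)))))) ⟩
        (c - q * u) * c * (X * P * Q * (v * q) * (C * i) * W) + (H J (suc (suc n)) - H J (suc n))
          -- The inverses for J+1 start one factor later than those for J. Inserting `vf J` · (1 - f
          -- q^J) supplies the missing one, and the balancing condition turns c (1 - f q^J) into the
          -- factor c - q^(J+1) α b of `rhs J`.
          ≈⟨ +-congʳ (times-one _ (vf-inverse J)) ⟩
        (c - q * u) * c * (X * P * Q * (v * q) * (C * i) * W) * (vf J * (1# - f * u))
          + (H J (suc (suc n)) - H J (suc n))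
          ≈⟨ +-congʳ (modulo (- ((c - q * u) * u * (X * P * Q * (v * q) * (C * i) * W) * vf J)) balanced
               (solve 13 (λ q u v α b c f X P Q D W a →
                  (c :- q :* u) :* c :* (X :* P :* Q :* (v :* q) :* D :* W) :* (a :* (:1 :- f :* u))
                    := (c :- q :* u) :* (c :- q :* u :* α :* b) :* (X :* P :* Q :* (v :* q) :* D :* (a :* W))
                       :+ :- ((c :- q :* u) :* u :* (X :* P :* Q :* (v :* q) :* D :* W) :* a)
                            :* (c :* f :- q :* α :* b))
                  refl q u v α b c f X P Q (C * i) W (vf J))) ⟩
        rhs J * (X * P * Q * (v * q) * (C * i) * (vf J * W)) + (H J (suc (suc n)) - H J (suc n))
          ≈⟨ +-congʳ (*-congˡ (*-congˡ (sym
               (trans (Π-suc n _) (*-cong (reflexive (≡.cong vf (ℕ.+-identityʳ J)))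
                 (Π-cong n (λ m → reflexive (≡.cong vf (ℕ.+-suc J m))))))))) ⟩
        rhs J * term J (suc n) + (H J (suc (suc n)) - H J (suc n)) ∎
        where
        u = q ^ J
        v = q ^ n
        X = gauss J (suc n)
        Y = gauss (suc J) n
        P = poch α (suc n)
        Q = poch b (suc n)
        C = Π< n vc
        i = vc n
        W = Π< n (λ m → vf (suc J ℕ.+ m))
        z = vf (suc J ℕ.+ n)
        M = P * Q * C * i * W * z
        z-inverse : z * (1# - f * (u * q * v)) ≈ 1#
        z-inverse = trans (*-congˡ (1-‿cong (*-congˡ (sym (Π-split (suc J) n _)))))
                          (vf-inverse (suc J ℕ.+ n))

      telescope : ∀ J n → lhs J * Σ< n (term (suc J)) ≈ rhs J * Σ< n (term J) + H J n
      telescope J zero = solve 2 (λ a b → a :* :0 := b :* :0 :+ :0) refl _ _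
      telescope J (suc n) = begin
        lhs J * (Σ< n (term (suc J)) + term (suc J) n)              ≈⟨ distribˡ _ _ _ ⟩
        lhs J * Σ< n (term (suc J)) + lhs J * term (suc J) n        ≈⟨ +-cong (telescope J n) (step J n) ⟩
        rhs J * Σ< n (term J) + H J n + (rhs J * term J n + (H J (suc n) - H J n))
          ≈⟨ solve 5 (λ r a b h h′ → r :* a :+ h :+ (r :* b :+ (h′ :- h)) := r :* (a :+ b) :+ h′)
               refl _ _ _ _ _ ⟩
        rhs J * (Σ< n (term J) + term J n) + H J (suc n)            ∎

    -- A terminating series has z = 1; in general z only has to annihilate poch α n.
    summation : ∀ z n → z * poch α n ≈ 0# → ∀ J →
      z * Σ< n (term J) * Π< J (λ s → (c - q * q ^ s * α) * (c - q * q ^ s * b))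
        ≈ z * Π< J (λ s → (c - q * q ^ s) * (c - q * q ^ s * α * b))
    summation z n zα≈0 zero = *-congʳ (base n zα≈0)
      where
      base : ∀ n → z * poch α n ≈ 0# → z * Σ< n (term 0) ≈ z
      -- The sum is empty here, but `poch α 0` is 1, so the hypothesis forces z = 0.
      base zero zα≈0 = trans (zeroʳ z) (trans (sym zα≈0) (*-identityʳ z))
      base (suc n) _ = trans (*-congˡ (begin
        Σ< (suc n) (term 0)                       ≈⟨ Σ-suc n (term 0) ⟩
        term 0 0 + Σ< n (term 0 ∘ suc)
          ≈⟨ +-cong (solve 0 (:1 :* :1 :* :1 :* :1 :* :1 :* :1 := :1) refl)
               (trans (Σ-cong n (λ k → solve 5 (λ a b c d e → :0 :* a :* b :* c :* d :* e := :0)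
                  refl _ _ _ _ _)) (Σ-zero n)) ⟩
        1# + 0#                                   ≈⟨ +-identityʳ 1# ⟩
        1#                                        ∎)) (*-identityʳ z)
    summation z n zα≈0 (suc J) = begin
      z * Σ< n (term (suc J)) * (Π< J lhs * lhs J)
        ≈⟨ solve 4 (λ z s p l → z :* s :* (p :* l) := z :* (l :* s) :* p) refl _ _ _ _ ⟩
      z * (lhs J * Σ< n (term (suc J))) * Π< J lhs
        ≈⟨ *-congʳ (trans (*-congˡ (telescope J n)) (trans (distribˡ z _ _)
             (trans (+-congˡ (zH≈0 n zα≈0)) (+-identityʳ _)))) ⟩
      z * (rhs J * Σ< n (term J)) * Π< J lhs
        ≈⟨ solve 4 (λ z r s p → z :* (r :* s) :* p := z :* s :* p :* r) refl _ _ _ _ ⟩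
      z * Σ< n (term J) * Π< J lhs * rhs J         ≈⟨ *-congʳ (summation z n zα≈0 J) ⟩
      z * Π< J rhs * rhs J                         ≈⟨ *-assoc _ _ _ ⟩
      z * (Π< J rhs * rhs J)                       ∎
      where
      zH≈0 : ∀ n → z * poch α n ≈ 0# → z * H J n ≈ 0#
      zH≈0 zero    _    = zeroʳ z
      zH≈0 (suc n) zα≈0 = begin
        z * H J (suc n)
          ≈⟨ solve 6 (λ z a p b c d → z :* (a :* p :* b :* c :* d) := z :* p :* (a :* b :* c :* d))
               refl _ _ _ _ _ _ ⟩
        z * poch α (suc n) * _                     ≈⟨ *-congʳ zα≈0 ⟩
        0# * _                                     ≈⟨ zeroˡ _ ⟩
        0#                                         ∎

-- Sears' transformation over a commutative ring

module Transformation {c ℓ : Level} (K : CommutativeRing c ℓ) (q : CommutativeRing.Carrier K) where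
  open CommutativeRing K
  open IntegerSolver K
  open SumsAndProducts K
  open QSeries K q
  open Summations K q
  open Relation.Binary.Reasoning.Setoid setoid

  Inverses : Carrier → (ℕ → Carrier) → Set ℓ
  Inverses x v = ∀ m → v m * (1# - x * q ^ m) ≈ 1#

  summand-cong : ∀ f f′ g g′ h h′ k k′ s s′ t t′ →
    f ≈ f′ → g ≈ g′ → h ≈ h′ → k ≈ k′ → s ≈ s′ → t ≈ t′ →
    f * g * h * k * s * t ≈ f′ * g′ * h′ * k′ * s′ * t′
  summand-cong _ _ _ _ _ _ _ _ _ _ _ _ p₁ p₂ p₃ p₄ p₅ p₆ =
    *-cong (*-cong (*-cong (*-cong (*-cong p₁ p₂) p₃) p₄) p₅) p₆

  poch-inverse : ∀ {x v} → Inverses x v → ∀ k → poch x k * Π< k v ≈ 1#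
  poch-inverse v-inverse k = trans (*-comm _ _) (Π-inverse k _ _ v-inverse)

  -- The factors of (q^(j+1) αz;q)_k are those of (qαz;q) from index j on, so one sequence of
  -- inverses serves the prefactor and the summands alike.
  shifted-poch-inverse : ∀ {α z v} → Inverses (q * α * z) v → ∀ j k →
    poch (q ^ suc j * α * z) k * Π< k (λ m → v (j ℕ.+ m)) ≈ 1#
  shifted-poch-inverse {α} {z} {v} v-inverse j k = trans (*-comm _ _) (Π-inverse k _ _ (λ m → trans
    (*-congˡ (1-‿cong (trans
      (solve 5 (λ q u α z w → u :* q :* α :* z :* w := q :* α :* z :* (u :* w)) refl q (q ^ j) α z (q ^ m))
      (*-congˡ (sym (Π-split j m _))))))
    (v-inverse (j ℕ.+ m))))

  -- Here x = d/(bc), ε = 1/e and y = bc/(de).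
  module Parameters
           (j N : ℕ) (α b c x e ε y : Carrier)
           (q-unit : Unit q) (x-unit : Unit x) (eε≈1 : e * ε ≈ 1#) (xey≈1 : x * e * y ≈ 1#)
           (vd ve vX vL vR vB : ℕ → Carrier)
           (vd-inverse : Inverses (x * b * c) vd)
           (ve-inverse : Inverses e ve)
           (vX-inverse : Inverses (x * e) vX)
           (vL-inverse : Inverses (q * α * y) vL)
           (vR-inverse : Inverses (q * α * ε) vR)
           (vB-inverse : Inverses (q * y) vB)
           (vanish : ∀ k → N ℕ.≤ k → poch α k ≈ 0#)
    where

    private
      X L R B E : Carrier
      X = x * e
      L = q * α * y
      R = q * α * ε
      B = q * y
      E = q * ε

      -- Reversing the factors 1 − X q^s turns them into X q^i − q^(s+1), up to a unit.
      κ : ℕ → ℕ → Carrier → Carrier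
      κ i n X = Π< n (λ s → X * q ^ i - q * q ^ s)

      -- This is (-1)^i q^(i(i+1)/2).
      κ₀ : ℕ → Carrier
      κ₀ zero    = 1#
      κ₀ (suc i) = - q * q ^ i * κ₀ i

      -‿unit : ∀ {u} → Unit u → Unit (- u)
      -‿unit {u} (v , vu≈1) = - v , trans (solve 2 (λ u v → :- v :* :- u := v :* u) refl u v) vu≈1

      κ₀-unit : ∀ i → Unit (κ₀ i)
      κ₀-unit zero    = 1# , *-identityˡ 1#
      κ₀-unit (suc i) = *-unit (*-unit (-‿unit q-unit) (^-unit i q-unit)) (κ₀-unit i)

      -- The factor s = 0 for i+1 is -q (1 - X q^i), the last factor of (X;q)_(i+1) up to -q; every
      -- later factor is q times one for i.
      κ-reverse : ∀ i X → κ i i X ≈ κ₀ i * poch X i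
      κ-reverse zero    X = sym (*-identityˡ 1#)
      κ-reverse (suc i) X = begin
        Π< (suc i) (λ s → X * (q ^ i * q) - q * q ^ s)
          ≈⟨ Π-suc i _ ⟩
        (X * (q ^ i * q) - q * 1#) * Π< i (λ s → X * (q ^ i * q) - q * (q ^ s * q))
          ≈⟨ *-congˡ (trans (Π-cong i (λ s → solve 4 (λ X q w v →
               X :* (w :* q) :- q :* (v :* q) := q :* (X :* w :- q :* v)) refl X q (q ^ i) (q ^ s)))
               (trans (Π-* i _ _) (*-congˡ (κ-reverse i X)))) ⟩
        (X * (q ^ i * q) - q * 1#) * (q ^ i * (κ₀ i * poch X i))
          ≈⟨ solve 5 (λ X q w k p → (X :* (w :* q) :- q :* :1) :* (w :* (k :* p))
                := :- q :* w :* k :* (p :* (:1 :- X :* w))) refl X q (q ^ i) (κ₀ i) (poch X i) ⟩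
        - q * q ^ i * κ₀ i * (poch X i * (1# - X * q ^ i))  ∎

      -- Beyond the first i factors, Z q^i - q^(i+s+1) = q^i Z (1 - q^(s+1)/Z). For Z = e and Z = X
      -- this produces the factorials (q/e;q)_j and (qbc/(de);q)_j of the prefactor.
      κ-split : ∀ i Z ζ → Z * ζ ≈ 1# →
        κ i (i ℕ.+ j) Z ≈ κ₀ i * poch Z i * ((q ^ i * Z) ^ j * poch (q * ζ) j)
      κ-split i Z ζ Zζ≈1 = trans (Π-split i j _) (*-cong (κ-reverse i Z)
        (trans (Π-cong j (λ s → begin
          Z * q ^ i - q * q ^ (i ℕ.+ s)             ≈⟨ +-congˡ (-‿cong (*-congˡ (Π-split i s _))) ⟩
          Z * q ^ i - q * (q ^ i * q ^ s)
            ≈⟨ modulo (q * q ^ i * q ^ s) Zζ≈1 (solve 5 (λ Z ζ q w v →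
                 Z :* w :- q :* (w :* v) := w :* Z :* (:1 :- q :* ζ :* v) :+ q :* w :* v :* (Z :* ζ :- :1))
                 refl Z ζ q (q ^ i) (q ^ s)) ⟩
          q ^ i * Z * (1# - q * ζ * q ^ s)          ∎)) (Π-* j _ _)))

      -- Balanced because X R = q α x, both sides being multiplied by q^i.
      module Inner (i : ℕ) = Saalschütz (α * q ^ i) x (X * q ^ i) R (λ m → vX (i ℕ.+ m)) vR
        (λ m → trans (*-congˡ (1-‿cong (trans (*-assoc _ _ _) (*-congˡ (sym (Π-split i m _))))))
                     (vX-inverse (i ℕ.+ m)))
        vR-inverse
        (modulo (x * q ^ i * q * α) eε≈1 (solve 6 (λ x e ε q w α →
           x :* e :* w :* (q :* α :* ε) := q :* (α :* w) :* x :+ x :* w :* q :* α :* (e :* ε :- :1))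
           refl x e ε q (q ^ i) α))

      S : ℕ → Carrier
      S i = Σ< (N ∸ i) (Inner.term i (i ℕ.+ j))

      -- The formula of `Inner` at J = i + j, its products rewritten as shifted factorials and freed
      -- of a common unit. The factor `poch α i` plays the part of z: (α;q)_i (αq^i;q)_(N∸i) is some
      -- (α;q)_k with k ≥ N, hence zero.
      inner-sum : ∀ i →
        poch α i * S i * x ^ i * poch e i * poch E j * poch L (i ℕ.+ j)
          ≈ poch α i * poch X i * poch B j * poch R (i ℕ.+ j)
      inner-sum i = unit-cancel U-unit (begin
        D * κ₀ i * x ^ j * (q ^ i * e) ^ j
          * (poch α i * S i * x ^ i * poch e i * poch E j * poch L n)
          ≈⟨ solve 10 (λ D k xʲ z s xⁱ e E L w →
               D :* k :* xʲ :* w :* (z :* s :* xⁱ :* e :* E :* L)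
                 := z :* s :* (D :* L :* (xⁱ :* xʲ :* (k :* e :* (w :* E)))))
               refl D (κ₀ i) (x ^ j) (poch α i) (S i) (x ^ i) (poch e i) (poch E j) (poch L n)
               ((q ^ i * e) ^ j) ⟩
        poch α i * S i * (D * poch L n * (x ^ i * x ^ j * (κ₀ i * poch e i * ((q ^ i * e) ^ j * poch E j))))
          ≈⟨ *-congˡ (*-congˡ (*-cong (sym (Π-split i j _)) (sym (κ-split i e ε eε≈1)))) ⟩
        poch α i * S i * (D * poch L n * (x ^ n * κ i n e))
          ≈⟨ *-congˡ (sym (trans (Π-cong n lhs-factor) (trans (Π-* n _ _)
               (*-cong (Π-* n _ _) (Π-* n _ _))))) ⟩
        poch α i * S i * Π< n (λ s → (X * q ^ i - q * q ^ s * (α * q ^ i)) * (X * q ^ i - q * q ^ s * x))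
          ≈⟨ Inner.summation i (poch α i) (N ∸ i)
               (trans (sym (poch-split α i (N ∸ i))) (vanish _ (ℕ.m≤n+m∸n N i))) n ⟩
        poch α i * Π< n (λ s → (X * q ^ i - q * q ^ s) * (X * q ^ i - q * q ^ s * (α * q ^ i) * x))
          ≈⟨ *-congˡ (trans (Π-cong n rhs-factor) (trans (Π-* n _ _) (*-congˡ (Π-* n _ _)))) ⟩
        poch α i * (κ i n X * (D * poch R n))
          ≈⟨ *-congˡ (*-congʳ (trans (κ-split i X y xey≈1) (*-congˡ (*-congʳ
               (trans (Π-cong j (λ _ → solve 3 (λ w x e → w :* (x :* e) := x :* (w :* e)) refl _ _ _))
                      (Π-* j _ _)))))) ⟩
        poch α i * (κ₀ i * poch X i * (x ^ j * (q ^ i * e) ^ j * poch B j) * (D * poch R n))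
          ≈⟨ solve 8 (λ D k xʲ z X B R w →
               z :* (k :* X :* (xʲ :* w :* B) :* (D :* R)) := D :* k :* xʲ :* w :* (z :* X :* B :* R))
               refl D (κ₀ i) (x ^ j) (poch α i) (poch X i) (poch B j) (poch R n) ((q ^ i * e) ^ j) ⟩
        D * κ₀ i * x ^ j * (q ^ i * e) ^ j * (poch α i * poch X i * poch B j * poch R n)  ∎)
        where
        n = i ℕ.+ j
        D = (q ^ i * X) ^ n
        e-unit : Unit e
        e-unit = ε , trans (*-comm ε e) eε≈1
        qⁱ-unit = ^-unit i q-unit
        U-unit : Unit (D * κ₀ i * x ^ j * (q ^ i * e) ^ j)
        U-unit = *-unit (*-unit (*-unit (^-unit n (*-unit qⁱ-unit (*-unit x-unit e-unit))) (κ₀-unit i))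
                   (^-unit j x-unit)) (^-unit j (*-unit qⁱ-unit e-unit))
        lhs-factor : ∀ s →
          (X * q ^ i - q * q ^ s * (α * q ^ i)) * (X * q ^ i - q * q ^ s * x)
            ≈ q ^ i * X * (1# - L * q ^ s) * (x * (e * q ^ i - q * q ^ s))
        lhs-factor s = modulo (q ^ i * q * α * q ^ s * (x * (e * q ^ i - q * q ^ s))) xey≈1
          (solve 7 (λ x e y q w v α →
            (x :* e :* w :- q :* v :* (α :* w)) :* (x :* e :* w :- q :* v :* x)
              := w :* (x :* e) :* (:1 :- q :* α :* y :* v) :* (x :* (e :* w :- q :* v))
                 :+ w :* q :* α :* v :* (x :* (e :* w :- q :* v)) :* (x :* e :* y :- :1))
            refl x e y q (q ^ i) (q ^ s) α)
        rhs-factor : ∀ s →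
          (X * q ^ i - q * q ^ s) * (X * q ^ i - q * q ^ s * (α * q ^ i) * x)
            ≈ (X * q ^ i - q * q ^ s) * (q ^ i * X * (1# - R * q ^ s))
        rhs-factor s = modulo ((X * q ^ i - q * q ^ s) * (q ^ i * x * q * α * q ^ s)) eε≈1
          (solve 7 (λ x e ε q w v α →
            (x :* e :* w :- q :* v) :* (x :* e :* w :- q :* v :* (α :* w) :* x)
              := (x :* e :* w :- q :* v) :* (w :* (x :* e) :* (:1 :- q :* α :* ε :* v))
                 :+ (x :* e :* w :- q :* v) :* (w :* x :* q :* α :* v) :* (e :* ε :- :1))
            refl x e ε q (q ^ i) (q ^ s) α)

    pref : Carrier
    pref = poch E j * poch L j * (Π< j vR * Π< j vB)

    lhs-term rhs-term : ℕ → Carrier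
    lhs-term k = gauss j k * poch α k * poch b k * poch c k * q ^ k
                   * (Π< k vd * Π< k ve * Π< k (λ m → vL (j ℕ.+ m)))
    rhs-term k = gauss j k * poch α k * poch (x * c) k * poch (x * b) k * q ^ k
                   * (Π< k vd * Π< k vX * Π< k (λ m → vR (j ℕ.+ m)))

    private
      module T = Terminating x b c vd vd-inverse

      outer : ℕ → Carrier
      outer i = gauss j i * poch α i * q ^ i * Π< i vX * Π< i (λ m → vR (j ℕ.+ m))
                  * (x ^ i * poch b i * poch c i * Π< i vd)

      -- After `T.summation`, the trinomial identity regroups the two binomials so that the inner
      -- index m enters only through `gauss (i + j) m`. This is why the inner sum has J = i + j.
      rhs-expand : ∀ k → rhs-term k ≈ Σ∕ k (λ i m → outer i * Inner.term i (i ℕ.+ j) m)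
      rhs-expand k = begin
        rhs-term k
          ≈⟨ solve 8 (λ g a b c q d X R → g :* a :* b :* c :* q :* (d :* X :* R)
                        := g :* a :* q :* X :* R :* (b :* c :* d)) refl _ _ _ _ _ _ _ _ ⟩
        A k * (poch (x * c) k * poch (x * b) k * Π< k vd)     ≈⟨ *-congˡ (T.summation k) ⟩
        A k * Σ∕ k T.F                                        ≈⟨ Σ∕-*ˡ k (A k) T.F ⟩
        Σ∕ k (λ i m → A k * T.F i m)                          ≈⟨ Σ∕-cong k _ _ entry ⟩
        Σ∕ k (λ i m → outer i * Inner.term i (i ℕ.+ j) m)     ∎
        where
        A : ℕ → Carrier
        A k = gauss j k * poch α k * q ^ k * Π< k vX * Π< k (λ m → vR (j ℕ.+ m))
        entry : ∀ i m → i ℕ.+ m ≡ k → A k * T.F i m ≈ outer i * Inner.term i (i ℕ.+ j) m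
        entry i m ≡.refl = begin
          A (i ℕ.+ m) * T.F i m
            ≈⟨ *-congʳ (*-cong (*-cong (*-cong (*-congˡ (poch-split α i m)) (Π-split i m _))
                 (Π-split i m vX)) (trans (Π-split i m _) (*-congˡ (Π-cong m (λ s →
                   reflexive (≡.cong vR (≡.trans (≡.sym (ℕ.+-assoc j i s))
                     (≡.cong (ℕ._+ s) (ℕ.+-comm j i))))))))) ⟩
          gauss j (i ℕ.+ m) * (poch α i * poch (α * q ^ i) m) * (q ^ i * q ^ m)
            * (Π< i vX * Π< m (λ s → vX (i ℕ.+ s)))
            * (Π< i (λ s → vR (j ℕ.+ s)) * Π< m (λ s → vR (i ℕ.+ j ℕ.+ s))) * T.F i m
            ≈⟨ solve 15 (λ G a a′ w w′ X X′ R R′ G′ p xⁱ b c d →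
                 G :* (a :* a′) :* (w :* w′) :* (X :* X′) :* (R :* R′) :* (G′ :* p :* xⁱ :* b :* c :* d)
                   := G :* G′ :* (a :* a′ :* (w :* w′) :* (X :* X′) :* (R :* R′) :* (p :* xⁱ :* b :* c :* d)))
                 refl (gauss j (i ℕ.+ m)) _ _ _ _ _ _ _ _ (gauss (suc i) m) _ _ _ _ _ ⟩
          gauss j (i ℕ.+ m) * gauss (suc i) m * _              ≈⟨ *-congʳ (gauss-trinomial j i m) ⟩
          gauss j i * gauss (i ℕ.+ j) m * _
            ≈⟨ solve 15 (λ G a a′ w w′ X X′ R R′ G′ p xⁱ b c d →
                 G :* G′ :* (a :* a′ :* (w :* w′) :* (X :* X′) :* (R :* R′) :* (p :* xⁱ :* b :* c :* d))
                   := G :* a :* w :* X :* R :* (xⁱ :* b :* c :* d) :* (G′ :* a′ :* p :* w′ :* X′ :* R′))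
                 refl (gauss j i) _ _ _ _ _ _ _ _ (gauss (i ℕ.+ j) m) _ _ _ _ _ ⟩
          outer i * Inner.term i (i ℕ.+ j) m                   ∎

      -- Inserting (e;q)_i and (Lq^j;q)_i with their inverses completes the left side of
      -- `inner-sum`; on its right side the factorials of X, B and R meet the inverses already
      -- present in `pref` and `outer`.
      outer-term : ∀ i → pref * (outer i * S i) ≈ lhs-term i
      outer-term i = begin
        pref * (outer i * S i)
          ≈⟨ times-one _ (trans (*-cong (Π-inverse i ve _ ve-inverse)
               (Π-inverse i (λ m → vL (j ℕ.+ m)) _ (λ m → vL-inverse (j ℕ.+ m)))) (*-identityˡ 1#)) ⟩
        pref * (outer i * S i) * (Π< i ve * poch e i * (Π< i (λ m → vL (j ℕ.+ m)) * Lʲ i))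
          ≈⟨ solve 18 (λ Eⱼ Lⱼ iR iB g a w X R xⁱ b c d s ve e vL L →
               Eⱼ :* Lⱼ :* (iR :* iB) :* (g :* a :* w :* X :* R :* (xⁱ :* b :* c :* d) :* s)
                   :* (ve :* e :* (vL :* L))
                 := a :* s :* xⁱ :* e :* Eⱼ :* (Lⱼ :* L)
                      :* (iR :* R :* iB :* X :* (g :* b :* c :* w :* (d :* ve :* vL))))
               refl (poch E j) (poch L j) _ _ _ (poch α i) _ _ _ (x ^ i) _ _ _ (S i) _ (poch e i) _ (Lʲ i) ⟩
        poch α i * S i * x ^ i * poch e i * poch E j * (poch L j * Lʲ i) * W
          ≈⟨ *-congʳ (trans (*-congˡ (trans (sym (Π-split j i _))
               (reflexive (≡.cong (poch L) (ℕ.+-comm j i))))) (inner-sum i)) ⟩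
        poch α i * poch X i * poch B j * poch R (i ℕ.+ j) * W
          ≈⟨ *-congʳ (*-congˡ (trans (reflexive (≡.cong (poch R) (ℕ.+-comm i j))) (Π-split j i _))) ⟩
        poch α i * poch X i * poch B j * (poch R j * Rʲ i) * W
          ≈⟨ solve 16 (λ a X′ B R Rʲ iR vR iB vX g b c w d ve vL →
               a :* X′ :* B :* (R :* Rʲ) :* (iR :* vR :* iB :* vX :* (g :* b :* c :* w :* (d :* ve :* vL)))
                 := g :* a :* b :* c :* w :* (d :* ve :* vL)
                      :* (iR :* R :* (vR :* Rʲ) :* (iB :* B :* (vX :* X′))))
               refl (poch α i) (poch X i) (poch B j) (poch R j) (Rʲ i) _ _ _ _ _ _ _ _ _ _ _ ⟩
        lhs-term i * (Π< j vR * poch R j * (Π< i (λ m → vR (j ℕ.+ m)) * Rʲ i)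
                       * (Π< j vB * poch B j * (Π< i vX * poch X i)))
          ≈⟨ sym (times-one _ (one⁴ (Π-inverse j vR _ vR-inverse)
               (Π-inverse i _ _ (λ m → vR-inverse (j ℕ.+ m)))
               (Π-inverse j vB _ vB-inverse) (Π-inverse i vX _ vX-inverse))) ⟩
        lhs-term i ∎
        where
        Lʲ Rʲ : ℕ → Carrier
        Lʲ i = Π< i (λ m → 1# - L * q ^ (j ℕ.+ m))
        Rʲ i = Π< i (λ m → 1# - R * q ^ (j ℕ.+ m))
        W = Π< j vR * Π< i (λ m → vR (j ℕ.+ m)) * Π< j vB * Π< i vX
              * (gauss j i * poch b i * poch c i * q ^ i * (Π< i vd * Π< i ve * Π< i (λ m → vL (j ℕ.+ m))))
        one⁴ : ∀ {p r s t} → p ≈ 1# → r ≈ 1# → s ≈ 1# → t ≈ 1# → p * r * (s * t) ≈ 1#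
        one⁴ p≈1 r≈1 s≈1 t≈1 = trans (*-cong (*-cong p≈1 r≈1) (*-cong s≈1 t≈1))
          (solve 0 (:1 :* :1 :* (:1 :* :1) := :1) refl)

    transformation : Σ< N lhs-term ≈ pref * Σ< N rhs-term
    transformation = sym (begin
      pref * Σ< N rhs-term
        ≈⟨ *-congˡ (trans (Σ-cong N rhs-expand) (Σ-triangle N _)) ⟩
      pref * Σ< N (λ i → Σ< (N ∸ i) (λ m → outer i * Inner.term i (i ℕ.+ j) m))
        ≈⟨ *-congˡ (Σ-cong N (λ i → sym (Σ-*ˡ (N ∸ i) (outer i) _))) ⟩
      pref * Σ< N (λ i → outer i * S i)     ≈⟨ Σ-*ˡ N pref _ ⟩
      Σ< N (λ i → pref * (outer i * S i))   ≈⟨ Σ-cong N outer-term ⟩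
      Σ< N lhs-term                         ∎)

-- The ring of formal power series in one variable

module FormalSeries {c ℓ : Level} (K : CommutativeRing c ℓ) where
  open CommutativeRing K
  open IntegerSolver K
  open SumsAndProducts K
  open Relation.Binary.Reasoning.Setoid setoid

  Series : Set c
  Series = ℕ → Carrier

  infix 4 _≋_
  _≋_ : Series → Series → Set ℓ
  f ≋ g = ∀ n → f n ≈ g n

  infixl 7 _⊛_
  _⊛_ : Series → Series → Series
  (f ⊛ g) n = Σ∕ n (λ i k → f i * g k)

  one : Series
  one zero    = 1#
  one (suc _) = 0#

  ⊛-cong : ∀ {f f′ g g′} → f ≋ f′ → g ≋ g′ → f ⊛ g ≋ f′ ⊛ g′
  ⊛-cong f≋f′ g≋g′ n = Σ∕-cong n _ _ (λ i k _ → *-cong (f≋f′ i) (g≋g′ k))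

  ⊛-identityˡ : ∀ f → one ⊛ f ≋ f
  ⊛-identityˡ f n = trans (Σ∕-head n (λ i k → one i * f k) (λ i k → zeroˡ _)) (*-identityˡ _)

  ⊛-distribˡ : ∀ f g h → f ⊛ (λ n → g n + h n) ≋ λ n → (f ⊛ g) n + (f ⊛ h) n
  ⊛-distribˡ f g h n = trans (Σ∕-cong n _ (λ i k → f i * g k + f i * h k) (λ i k _ → distribˡ _ _ _))
    (Σ∕-+ n (λ i k → f i * g k) (λ i k → f i * h k))

  ⊛-suc : ∀ f g n → (f ⊛ g) (suc n) ≈ f 0 * g (suc n) + (f ∘ suc ⊛ g) n
  ⊛-suc f g n = Σ∕-suc n (λ i k → f i * g k)

  ⊛-suc′ : ∀ f g n → (f ⊛ g) (suc n) ≈ (f ⊛ g ∘ suc) n + f (suc n) * g 0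
  ⊛-suc′ f g n = +-cong
    (Σ-cong< (suc n) (λ i i<1+n →
      *-congˡ (reflexive (≡.cong g (ℕ.+-∸-assoc 1 (ℕ.≤-pred i<1+n))))))
    (*-congˡ (reflexive (≡.cong g (ℕ.n∸n≡0 n))))

  -- Splitting off the first entry of one product corresponds to splitting off the last entry of the
  -- other.
  ⊛-comm : ∀ f g → f ⊛ g ≋ g ⊛ f
  ⊛-comm f g zero    = +-congˡ (*-comm _ _)
  ⊛-comm f g (suc n) = begin
    (f ⊛ g) (suc n)                           ≈⟨ ⊛-suc f g n ⟩
    f 0 * g (suc n) + (f ∘ suc ⊛ g) n         ≈⟨ +-cong (*-comm _ _) (⊛-comm (f ∘ suc) g n) ⟩
    g (suc n) * f 0 + (g ⊛ f ∘ suc) n         ≈⟨ +-comm _ _ ⟩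
    (g ⊛ f ∘ suc) n + g (suc n) * f 0         ≈⟨ sym (⊛-suc′ g f n) ⟩
    (g ⊛ f) (suc n)                           ∎

  ⊛-distribʳ : ∀ f g h → (λ n → g n + h n) ⊛ f ≋ λ n → (g ⊛ f) n + (h ⊛ f) n
  ⊛-distribʳ f g h n = trans (⊛-comm (λ n → g n + h n) f n)
    (trans (⊛-distribˡ f g h n) (+-cong (⊛-comm f g n) (⊛-comm f h n)))

  ⊛-scale : ∀ x f g → (λ n → x * f n) ⊛ g ≋ λ n → x * (f ⊛ g) n
  ⊛-scale x f g n = trans (Σ∕-cong n _ (λ i k → x * (f i * g k)) (λ i k _ → *-assoc _ _ _))
    (sym (Σ∕-*ˡ n x (λ i k → f i * g k)))

  -- Induction on the exponent for all f at once: without its constant term f becomes `f ∘ suc`, and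
  -- the constant term contributes by linearity.
  ⊛-assoc : ∀ f g h → (f ⊛ g) ⊛ h ≋ f ⊛ (g ⊛ h)
  ⊛-assoc f g h zero =
    solve 3 (λ a b c → :0 :+ (:0 :+ a :* b) :* c := :0 :+ a :* (:0 :+ b :* c)) refl _ _ _
  ⊛-assoc f g h (suc n) = begin
    ((f ⊛ g) ⊛ h) (suc n)
      ≈⟨ ⊛-suc (f ⊛ g) h n ⟩
    (0# + f 0 * g 0) * h (suc n) + ((f ⊛ g) ∘ suc ⊛ h) n
      ≈⟨ +-congˡ (trans (⊛-cong {g = h} (⊛-suc f g) (λ _ → refl) n)
           (trans (⊛-distribʳ h (λ m → f 0 * g (suc m)) (f ∘ suc ⊛ g) n)
             (+-cong (⊛-scale (f 0) (g ∘ suc) h n) (⊛-assoc (f ∘ suc) g h n)))) ⟩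
    (0# + f 0 * g 0) * h (suc n) + (f 0 * (g ∘ suc ⊛ h) n + (f ∘ suc ⊛ (g ⊛ h)) n)
      ≈⟨ solve 5 (λ a b c d e → (:0 :+ a :* b) :* c :+ (a :* d :+ e) := a :* (b :* c :+ d) :+ e)
           refl _ _ _ _ _ ⟩
    f 0 * (g 0 * h (suc n) + (g ∘ suc ⊛ h) n) + (f ∘ suc ⊛ (g ⊛ h)) n
      ≈⟨ +-congʳ (*-congˡ (sym (⊛-suc g h n))) ⟩
    f 0 * (g ⊛ h) (suc n) + (f ∘ suc ⊛ (g ⊛ h)) n
      ≈⟨ sym (⊛-suc f (g ⊛ h) n) ⟩
    (f ⊛ (g ⊛ h)) (suc n)                     ∎

  seriesRing : CommutativeRing c ℓ
  seriesRing = record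
    { Carrier = Series
    ; _≈_ = _≋_
    ; _+_ = λ f g n → f n + g n
    ; _*_ = _⊛_
    ; -_ = λ f n → - f n
    ; 0# = λ _ → 0#
    ; 1# = one
    ; isCommutativeRing = record
      { isRing = record
        { +-isAbelianGroup = Pointwise.isAbelianGroup +-isAbelianGroup
        ; *-cong = ⊛-cong
        ; *-assoc = ⊛-assoc
        ; *-identity = ⊛-identityˡ , λ f n → trans (⊛-comm f one n) (⊛-identityˡ f n)
        ; distrib = ⊛-distribˡ , ⊛-distribʳ
        }
      ; *-comm = ⊛-comm
      }
    }
    where module Pointwise = Algebra.Construct.Pointwise ℕ

-- Series in a and r: ring structure, order, truncation, inverses

module DoubleSeries {c ℓ : Level} (𝔽 : CharZeroField c ℓ) where
  open CharZeroField 𝔽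
  open PowerSeries 𝔽
  open IntegerSolver commRing
  open SumsAndProducts commRing using (Σ∕; Σ∕-cong; Σ∕-head; Σ-cong; Σ-zero)
  private
    module S = SumsAndProducts commRing
    module S₁ = FormalSeries commRing
    module S₂ = FormalSeries S₁.seriesRing
    module T = SumsAndProducts S₁.seriesRing
    module R₂ = CommutativeRing S₂.seriesRing
  open Relation.Binary.Reasoning.Setoid setoid

  Σ<≡ : ∀ n f → Σ< n f ≡ S.Σ< n f
  Σ<≡ zero    f = ≡.refl
  Σ<≡ (suc n) f = ≡.cong (_+ f n) (Σ<≡ n f)

  *ₚ-coefficient : ∀ f g m n →
    (f *ₚ g) m n ≈ Σ∕ m (λ i i′ → Σ∕ n (λ k k′ → f i k * g i′ k′))
  *ₚ-coefficient f g m n = trans (reflexive (Σ<≡ (suc m) _))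
    (Σ-cong (suc m) (λ i → reflexive (Σ<≡ (suc n) _)))

  Σ-eval : ∀ n (G : ℕ → ℕ → Carrier) k → T.Σ< n G k ≈ S.Σ< n (λ i → G i k)
  Σ-eval zero    G k = refl
  Σ-eval (suc n) G k = +-congʳ (Σ-eval n G k)

  *ₚ≈⊛ : ∀ f g → f *ₚ g ≈ₚ f S₂.⊛ g
  *ₚ≈⊛ f g m n = trans (*ₚ-coefficient f g m n) (sym (Σ-eval (suc m) _ n))

  1ₚ≈one : 1ₚ ≈ₚ S₂.one
  1ₚ≈one zero    zero    = refl
  1ₚ≈one zero    (suc _) = refl
  1ₚ≈one (suc _) zero    = refl
  1ₚ≈one (suc _) (suc _) = refl

  -- Power series compared only at the exponents in a down-closed set P.
  module Comparison (P : ℕ → ℕ → Set)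
                    (P-down : ∀ {m n i k} → i ℕ.≤ m → k ℕ.≤ n → P m n → P i k) where

    infix 4 _≈ᴾ_
    _≈ᴾ_ : PS → PS → Set ℓ
    f ≈ᴾ g = ∀ m n → P m n → f m n ≈ g m n

    restrict : ∀ {f g} → f ≈ₚ g → f ≈ᴾ g
    restrict f≈g m n _ = f≈g m n

    -- The coefficient of a product at (m, n) involves only exponents below (m, n); this is where
    -- down-closure enters.
    *ₚ-cong : ∀ {f f′ g g′} → f ≈ᴾ f′ → g ≈ᴾ g′ → f *ₚ g ≈ᴾ f′ *ₚ g′
    *ₚ-cong {f} {f′} {g} {g′} f≈f′ g≈g′ m n p = trans (*ₚ-coefficient f g m n) (trans
      (Σ∕-cong m _ (λ i i′ → Σ∕ n (λ k k′ → f′ i k * g′ i′ k′)) (λ i i′ i+i′≡m →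
        Σ∕-cong n _ (λ k k′ → f′ i k * g′ i′ k′) (λ k k′ k+k′≡n →
          *-cong (f≈f′ i k (P-down (ℕ.m+n≤o⇒m≤o i (ℕ.≤-reflexive i+i′≡m))
                                   (ℕ.m+n≤o⇒m≤o k (ℕ.≤-reflexive k+k′≡n)) p))
                 (g≈g′ i′ k′ (P-down (ℕ.m+n≤o⇒n≤o i (ℕ.≤-reflexive i+i′≡m))
                                     (ℕ.m+n≤o⇒n≤o k (ℕ.≤-reflexive k+k′≡n)) p)))))
      (sym (*ₚ-coefficient f′ g′ m n)))

    private
      infixr 5 _⨾_
      _⨾_ : ∀ {f g h} → f ≈ₚ g → g ≈ₚ h → f ≈ₚ h
      _⨾_ = R₂.trans

      identityˡ : ∀ f → 1ₚ *ₚ f ≈ₚ f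
      identityˡ f = *ₚ≈⊛ 1ₚ f ⨾ R₂.*-congʳ {f} 1ₚ≈one ⨾ R₂.*-identityˡ f

      comm : ∀ f g → f *ₚ g ≈ₚ g *ₚ f
      comm f g = *ₚ≈⊛ f g ⨾ R₂.*-comm f g ⨾ R₂.sym (*ₚ≈⊛ g f)

      distribˡ′ : ∀ f g h → f *ₚ (g +ₚ h) ≈ₚ (f *ₚ g) +ₚ (f *ₚ h)
      distribˡ′ f g h = *ₚ≈⊛ f (g +ₚ h) ⨾ R₂.distribˡ f g h
        ⨾ R₂.+-cong (R₂.sym (*ₚ≈⊛ f g)) (R₂.sym (*ₚ≈⊛ f h))

      assoc : ∀ f g h → (f *ₚ g) *ₚ h ≈ₚ f *ₚ (g *ₚ h)
      assoc f g h = *ₚ≈⊛ (f *ₚ g) h ⨾ R₂.*-congʳ {h} (*ₚ≈⊛ f g) ⨾ R₂.*-assoc f g h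
        ⨾ R₂.*-congˡ {f} (R₂.sym (*ₚ≈⊛ g h)) ⨾ R₂.sym (*ₚ≈⊛ f (g *ₚ h))

    comparisonRing : CommutativeRing c ℓ
    comparisonRing = record
      { Carrier = PS
      ; _≈_ = _≈ᴾ_
      ; _+_ = _+ₚ_
      ; _*_ = _*ₚ_
      ; -_ = λ f m n → - f m n
      ; 0# = λ _ _ → 0#
      ; 1# = 1ₚ
      ; isCommutativeRing = record
        { isRing = record
          { +-isAbelianGroup = record
            { isGroup = record
              { isMonoid = record
                { isSemigroup = record
                  { isMagma = record
                    { isEquivalence = record
                      { refl = λ _ _ _ → refl
                      ; sym = λ f≈g m n p → sym (f≈g m n p)
                      ; trans = λ f≈g g≈h m n p → trans (f≈g m n p) (g≈h m n p)
                      }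
                    ; ∙-cong = λ f≈f′ g≈g′ m n p → +-cong (f≈f′ m n p) (g≈g′ m n p)
                    }
                  ; assoc = λ f g h → restrict (R₂.+-assoc f g h)
                  }
                ; identity = (λ f → restrict (R₂.+-identityˡ f)) , (λ f → restrict (R₂.+-identityʳ f))
                }
              ; inverse = (λ f → restrict (R₂.-‿inverseˡ f)) , (λ f → restrict (R₂.-‿inverseʳ f))
              ; ⁻¹-cong = λ f≈g m n p → -‿cong (f≈g m n p)
              }
            ; comm = λ f g → restrict (R₂.+-comm f g)
            }
          ; *-cong = *ₚ-cong
          ; *-assoc = λ f g h → restrict (assoc f g h)
          ; *-identity = (λ f → restrict (identityˡ f))
                       , (λ f → restrict (comm f 1ₚ ⨾ identityˡ f))
          ; distrib = (λ f g h → restrict (distribˡ′ f g h))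
                    , (λ f g h → restrict (comm (g +ₚ h) f ⨾ distribˡ′ f g h
                         ⨾ R₂.+-cong (comm f g) (comm f h)))
          }
        ; *-comm = λ f g → restrict (comm f g)
        }
      }

    module C = CommutativeRing comparisonRing
    module SP = SumsAndProducts comparisonRing
    module Q = QSeries comparisonRing q

    ^ₚ≡^ : ∀ f k → f ^ₚ k ≡ f SP.^ k
    ^ₚ≡^ f zero    = ≡.refl
    ^ₚ≡^ f (suc k) = ≡.cong (_*ₚ f) (^ₚ≡^ f k)

    poch≡ : ∀ f k → poch f k ≡ Q.poch f k
    poch≡ f zero    = ≡.refl
    poch≡ f (suc k) = ≡.cong₂ (λ g h → g *ₚ (1ₚ -ₚ f *ₚ h)) (poch≡ f k) (^ₚ≡^ q k)

    Σ-coefficient : ∀ k (G : ℕ → PS) m n → SP.Σ< k G m n ≈ S.Σ< k (λ i → G i m n)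
    Σ-coefficient zero    G m n = refl
    Σ-coefficient (suc k) G m n = +-congʳ (Σ-coefficient k G m n)

  constant : ∀ f g → (f *ₚ g) 0 0 ≈ f 0 0 * g 0 0
  constant f g = trans (+-identityˡ _) (+-identityˡ _)

  1≉0 : ¬ (1# ≈ 0#)
  1≉0 1≈0 = charZero 0 (trans (+-identityʳ 1#) 1≈0)

  const-*ₚ : ∀ x f m n → (const x *ₚ f) m n ≈ x * f m n
  const-*ₚ x f m n = trans (*ₚ-coefficient (const x) f m n) (trans
    (Σ∕-head m (λ i i′ → Σ∕ n (λ k k′ → const x i k * f i′ k′))
      (λ i i′ → trans (Σ-cong (suc n) (λ k → zeroˡ _)) (Σ-zero (suc n))))
    (Σ∕-head n (λ k k′ → const x 0 k * f m k′) (λ k k′ → zeroˡ _)))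

  const-* : ∀ x y → const x *ₚ const y ≈ₚ const (x * y)
  const-* x y m n = trans (const-*ₚ x (const y) m n) (cases m n)
    where
    cases : ∀ m n → x * const y m n ≈ const (x * y) m n
    cases zero    zero    = refl
    cases zero    (suc n) = zeroʳ x
    cases (suc m) zero    = zeroʳ x
    cases (suc m) (suc n) = zeroʳ x

  const-cong : ∀ {x y} → x ≈ y → const x ≈ₚ const y
  const-cong x≈y zero    zero    = x≈y
  const-cong x≈y zero    (suc n) = refl
  const-cong x≈y (suc m) zero    = refl
  const-cong x≈y (suc m) (suc n) = refl

  Order≥ : ℕ → PS → Set ℓ
  Order≥ N f = ∀ m n → m ℕ.+ n ℕ.< N → f m n ≈ 0#

  order-* : ∀ {M N f g} → Order≥ M f → Order≥ N g → Order≥ (M ℕ.+ N) (f *ₚ g)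
  order-* {M} {N} {f} {g} f≥M g≥N m n m+n<M+N = trans (*ₚ-coefficient f g m n) (trans
    (Σ∕-cong m _ (λ _ _ → 0#) (λ i i′ i+i′≡m →
      trans (Σ∕-cong n _ (λ _ _ → 0#) (λ k k′ k+k′≡n → entry i i′ k k′ i+i′≡m k+k′≡n)) (Σ-zero (suc n))))
    (Σ-zero (suc m)))
    where
    entry : ∀ i i′ k k′ → i ℕ.+ i′ ≡ m → k ℕ.+ k′ ≡ n → f i k * g i′ k′ ≈ 0#
    entry i i′ k k′ ≡.refl ≡.refl with i ℕ.+ k ℕ.<? M | i′ ℕ.+ k′ ℕ.<? N
    ... | yes i+k<M | _           = trans (*-congʳ (f≥M i k i+k<M)) (zeroˡ _)
    ... | no _      | yes i′+k′<N = trans (*-congˡ (g≥N i′ k′ i′+k′<N)) (zeroʳ _)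
    ... | no i+k≮M  | no i′+k′≮N  with () ← ℕ.<⇒≱ m+n<M+N (ℕ.≤-trans
      (ℕ.+-mono-≤ (ℕ.≮⇒≥ i+k≮M) (ℕ.≮⇒≥ i′+k′≮N))
      (ℕ.≤-reflexive (ℕ-interchange i k i′ k′)))

  order-*ʳ : ∀ {N f} g → Order≥ N f → Order≥ N (f *ₚ g)
  order-*ʳ {N} g f≥N = ≡.subst (λ M → Order≥ M _) (ℕ.+-identityʳ N) (order-* {g = g} f≥N (λ _ _ ()))

  order-*ˡ : ∀ {N g} f → Order≥ N g → Order≥ N (f *ₚ g)
  order-*ˡ f g≥N = order-* {M = 0} {f = f} (λ _ _ ()) g≥N

  order-suc : ∀ {N f g} → Order≥ N f → g 0 0 ≈ 0# → Order≥ (suc N) (f *ₚ g)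
  order-suc {N} {f} {g} f≥N g₀≈0 = ≡.subst (λ M → Order≥ M (f *ₚ g)) (ℕ.+-comm N 1)
    (order-* {g = g} f≥N λ where
      zero    zero    _ → g₀≈0
      zero    (suc _) (ℕ.s≤s ())
      (suc _) _       (ℕ.s≤s ()))

  module Exact = Comparison (λ _ _ → ⊤) (λ _ _ _ → tt)

  module Truncation (N : ℕ) = Comparison (λ m n → m ℕ.+ n ℕ.≤ N)
    (λ i≤m k≤n → ℕ.≤-trans (ℕ.+-mono-≤ i≤m k≤n))

  Σ-pad : ∀ n d f → (∀ k → n ℕ.≤ k → f k ≈ 0#) → S.Σ< (d ℕ.+ n) f ≈ S.Σ< n f
  Σ-pad n zero    f f≈0 = refl
  Σ-pad n (suc d) f f≈0 = trans (+-cong (Σ-pad n d f f≈0) (f≈0 _ (ℕ.m≤n+m n d))) (+-identityʳ _)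

  -- Only the terms k ≤ m + n reach the coefficient of a^m r^n.
  truncated-sum : ∀ N (G : ℕ → PS) → (∀ k → Order≥ k (G k)) → ∀ m n → m ℕ.+ n ℕ.≤ N →
    Σ< (suc (m ℕ.+ n)) (λ k → G k m n) ≈ S.Σ< (suc N) (λ k → G k m n)
  truncated-sum N G G≥ m n m+n≤N = begin
    Σ< (suc (m ℕ.+ n)) (λ k → G k m n)              ≡⟨ Σ<≡ (suc (m ℕ.+ n)) _ ⟩
    S.Σ< (suc (m ℕ.+ n)) (λ k → G k m n)
      ≈⟨ sym (Σ-pad (suc (m ℕ.+ n)) (N ∸ (m ℕ.+ n)) _ (λ k m+n<k → G≥ k m n m+n<k)) ⟩
    S.Σ< (N ∸ (m ℕ.+ n) ℕ.+ suc (m ℕ.+ n)) (λ k → G k m n)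
      ≡⟨ ≡.cong (λ M → S.Σ< M (λ k → G k m n))
           (≡.trans (ℕ.+-suc (N ∸ (m ℕ.+ n)) (m ℕ.+ n)) (≡.cong suc (ℕ.m∸n+n≡m m+n≤N))) ⟩
    S.Σ< (suc N) (λ k → G k m n)                    ∎

  tsum-truncation : ∀ N G → (∀ k → Order≥ k (G k)) →
    let open Truncation N in tsum G ≈ᴾ SP.Σ< (suc N) G
  tsum-truncation N G G≥ m n m+n≤N = trans (truncated-sum N G G≥ m n m+n≤N)
    (sym (Truncation.Σ-coefficient N (suc N) G m n))

  order-zero : ∀ N {f} → Order≥ (suc N) f → let open Truncation N in f ≈ᴾ C.0#
  order-zero N f>N m n m+n≤N = f>N m n (ℕ.s≤s m+n≤N)

  -- For the coefficient at (m, n) it suffices to work up to total order N = m + n. There `invₚ f`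
  -- is a fixed finite geometric sum in h, const a · f is 1 - h, and h^(N+1) vanishes.
  invₚ-inverse : ∀ f → ¬ (f 0 0 ≈ 0#) → f *ₚ invₚ f ≈ₚ 1ₚ
  invₚ-inverse f f₀≉0 m n = inverse-mod m n ℕ.≤-refl
    where
    N = m ℕ.+ n
    open Truncation N
    a = f 0 0 ⁻¹
    h = 1ₚ -ₚ (const a *ₚ f)

    h-order : ∀ k → Order≥ k (h ^ₚ k)
    h-order zero    = λ _ _ ()
    h-order (suc k) = order-suc {f = h ^ₚ k} {g = h} (h-order k) (begin
      1# - (const a *ₚ f) 0 0    ≈⟨ +-congˡ (-‿cong (trans (const-*ₚ a f 0 0)
                                      (trans (*-comm _ _) (⁻¹-inverse _ f₀≉0)))) ⟩
      1# - 1#                    ≈⟨ -‿inverseʳ 1# ⟩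
      0#                         ∎)

    module I = IntegerSolver comparisonRing

    invₚ-mod : invₚ f ≈ᴾ const a *ₚ SP.Σ< (suc N) (h SP.^_)
    invₚ-mod m n m+n≤N = begin
      a * Σ< (suc (m ℕ.+ n)) (λ k → (h ^ₚ k) m n)
        ≈⟨ *-congˡ (truncated-sum N (h ^ₚ_) h-order m n m+n≤N) ⟩
      a * S.Σ< (suc N) (λ k → (h ^ₚ k) m n)
        ≈⟨ *-congˡ (Σ-cong (suc N) (λ k → reflexive (≡.cong (λ g → g m n) (^ₚ≡^ h k)))) ⟩
      a * S.Σ< (suc N) (λ k → (h SP.^ k) m n)           ≈⟨ *-congˡ (sym (Σ-coefficient (suc N) _ m n)) ⟩
      a * SP.Σ< (suc N) (h SP.^_) m n                   ≈⟨ sym (const-*ₚ a (SP.Σ< (suc N) (h SP.^_)) m n) ⟩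
      (const a *ₚ SP.Σ< (suc N) (h SP.^_)) m n          ∎

    inverse-mod : f *ₚ invₚ f ≈ᴾ 1ₚ
    inverse-mod = C.trans (C.*-congˡ {f} invₚ-mod) (C.trans
      (I.solve 3 (λ f a s → f I.:* (a I.:* s) I.:= (I.:1 I.:- (I.:1 I.:- a I.:* f)) I.:* s) C.refl
        f (const a) (SP.Σ< (suc N) (h SP.^_)))
      (C.trans (SP.geometric (suc N) h) (C.trans
        (SP.1-‿cong (C.trans (C.reflexive (≡.sym (^ₚ≡^ h (suc N)))) (order-zero N (h-order (suc N)))))
        (I.solve 1 (λ o → I.:1 I.:- I.:0 I.:= I.:1) C.refl 1ₚ))))

  q-constant : ∀ k → (q ^ₚ k) 0 0 ≈ 1#
  q-constant zero    = refl
  q-constant (suc k) = trans (constant (q ^ₚ k) q) (trans (*-congʳ (q-constant k))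
    (solve 0 (:1 :* (:1 :- :0) := :1) refl))

  -- Since q is 1 at r = 0, all factors of a shifted factorial have the same constant term, and one
  -- hypothesis per denominator parameter makes them all invertible.
  factor-constant : ∀ f k → (1ₚ -ₚ f *ₚ (q ^ₚ k)) 0 0 ≈ 1# - f 0 0
  factor-constant f k = +-congˡ (-‿cong (trans (constant f (q ^ₚ k))
    (trans (*-congˡ (q-constant k)) (*-identityʳ _))))

  factor-inverse : ∀ f → ¬ (1# - f 0 0 ≈ 0#) → ∀ k →
    (1ₚ -ₚ f *ₚ (q ^ₚ k)) *ₚ invₚ (1ₚ -ₚ f *ₚ (q ^ₚ k)) ≈ₚ 1ₚ
  factor-inverse f 1-f₀≉0 k =
    invₚ-inverse _ (λ ≈0 → 1-f₀≉0 (trans (sym (factor-constant f k)) ≈0))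

  -- Every factor 1 - (1-a) q^s has constant term zero and so raises the order by one.
  poch-order : ∀ k → Order≥ k (poch (1ₚ -ₚ A) k)
  poch-order zero    = λ _ _ ()
  poch-order (suc k) = order-suc {f = poch (1ₚ -ₚ A) k} {g = 1ₚ -ₚ (1ₚ -ₚ A) *ₚ (q ^ₚ k)} (poch-order k)
    (trans (factor-constant (1ₚ -ₚ A) k) (solve 1 (λ o → o :- (o :- :0) := :0) refl 1#))

-- Uniqueness of reciprocals

module Reciprocals {c ℓ : Level} (𝔽 : CharZeroField c ℓ)
                   (P : ℕ → ℕ → Set) (P-zero : P 0 0)
                   (P-down : ∀ {m n i k} → i ℕ.≤ m → k ℕ.≤ n → P m n → P i k) where
  open CharZeroField 𝔽
  open PowerSeries 𝔽
  open DoubleSeries 𝔽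
  open Comparison P P-down

  -- Because (0, 0) lies in P, the equation f g = 1 shows that f has nonzero constant term. Then
  -- `invₚ f` is a true inverse, and inverses are unique.
  invₚ-unique : ∀ f g → f *ₚ g ≈ᴾ 1ₚ → invₚ f ≈ᴾ g
  invₚ-unique f g fg≈1 = begin
    invₚ f                  ≈⟨ SP.times-one (invₚ f) fg≈1 ⟩
    invₚ f *ₚ (f *ₚ g)      ≈⟨ C.sym (C.*-assoc (invₚ f) f g) ⟩
    invₚ f *ₚ f *ₚ g
      ≈⟨ C.*-congʳ {g} (C.trans (C.*-comm (invₚ f) f) (restrict (invₚ-inverse f f₀≉0))) ⟩
    1ₚ *ₚ g                 ≈⟨ C.*-identityˡ g ⟩
    g                       ∎
    where
    open Relation.Binary.Reasoning.Setoid C.setoid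
    f₀≉0 : ¬ (f 0 0 ≈ 0#)
    f₀≉0 f₀≈0 = 1≉0 (trans (sym (fg≈1 0 0 P-zero))
      (trans (constant f g) (trans (*-congʳ f₀≈0) (zeroˡ _))))

-- The quotient of shifted factorials as a Gaussian binomial

module GaussianBinomials {c ℓ : Level} (𝔽 : CharZeroField c ℓ) where
  open CharZeroField 𝔽
  open PowerSeries 𝔽
  open DoubleSeries 𝔽
  open Exact
  open Reciprocals 𝔽 (λ _ _ → ⊤) tt (λ _ _ _ → tt)
  module SF = SumsAndProducts commRing

  divR-cong : ∀ {f g} k → f ≈ₚ g → divR^ k f ≈ₚ divR^ k g
  divR-cong zero    f≈g = f≈g
  divR-cong (suc k) f≈g m n = divR-cong k f≈g m (suc n)

  divR-R : ∀ f → divR (R *ₚ f) ≈ₚ f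
  divR-R f m n = begin
    (R *ₚ f) m (suc n)                                         ≈⟨ *ₚ-coefficient R f m (suc n) ⟩
    SF.Σ∕ m (λ i i′ → SF.Σ∕ (suc n) (λ k k′ → R i k * f i′ k′))
      ≈⟨ SF.Σ∕-head m (λ i i′ → SF.Σ∕ (suc n) (λ k k′ → R i k * f i′ k′)) (λ i i′ →
           trans (SF.Σ-cong (suc (suc n)) (λ k → zeroˡ _)) (SF.Σ-zero (suc (suc n)))) ⟩
    SF.Σ∕ (suc n) (λ k k′ → R 0 k * f m k′)                    ≈⟨ SF.Σ∕-suc n (λ k k′ → R 0 k * f m k′) ⟩
    0# * f m (suc n) + SF.Σ∕ n (λ k k′ → R 0 (suc k) * f m k′)
      ≈⟨ +-cong (zeroˡ _) (SF.Σ∕-head n (λ k k′ → R 0 (suc k) * f m k′) (λ k k′ → zeroˡ _)) ⟩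
    0# + 1# * f m n                                            ≈⟨ trans (+-identityˡ _) (*-identityˡ _) ⟩
    f m n                                                      ∎
    where open Relation.Binary.Reasoning.Setoid setoid

  divR^-R^ : ∀ k f → divR^ k (R SP.^ k *ₚ f) ≈ₚ f
  divR^-R^ zero    f m n = C.*-identityˡ f m n tt
  divR^-R^ (suc k) f m n = trans
    (divR-cong k (λ m n → C.*-assoc (R SP.^ k) R f m n tt) m (suc n))
    (trans (divR^-R^ k (R *ₚ f) m (suc n)) (divR-R f m n))

  -- 1 − q^(m+1) = r W m
  W : ℕ → PS
  W m = SP.Σ< (suc m) (q SP.^_)

  -- At r = 0 each of the m+1 powers of q becomes 1. Characteristic zero then makes `W m`
  -- invertible.
  W-constant : ∀ m → W m 0 0 ≈ (commRing ×1) (suc m)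
  W-constant m = trans (Σ-coefficient (suc m) (q SP.^_) 0 0) (count (suc m))
    where
    count : ∀ m → SF.Σ< m (λ k → (q SP.^ k) 0 0) ≈ (commRing ×1) m
    count zero    = refl
    count (suc m) = trans (+-comm _ _) (+-cong
      (trans (reflexive (≡.cong (λ f → f 0 0) (≡.sym (^ₚ≡^ q m)))) (q-constant m)) (count m))

  R-factor : ∀ m → 1ₚ -ₚ q *ₚ (q SP.^ m) ≈ᴾ R *ₚ W m
  R-factor m = begin
    1ₚ -ₚ q *ₚ (q SP.^ m)    ≈⟨ SP.1-‿cong (C.*-comm q (q SP.^ m)) ⟩
    1ₚ -ₚ q SP.^ suc m       ≈⟨ C.sym (SP.geometric (suc m) q) ⟩
    (1ₚ -ₚ q) *ₚ W m
      ≈⟨ C.*-congʳ {W m} (I.solve 2 (λ o r → o I.:- (o I.:- r) I.:= r) C.refl 1ₚ R) ⟩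
    R *ₚ W m                 ∎
    where
    open Relation.Binary.Reasoning.Setoid C.setoid
    module I = IntegerSolver comparisonRing

  poch-q : ∀ k → poch q k ≈ᴾ R SP.^ k *ₚ SP.Π< k W
  poch-q k = C.trans (C.reflexive (poch≡ q k)) (C.trans (SP.Π-cong k R-factor) (SP.Π-* k _ W))

  -- Numerator and denominator both contain r^k times the product of the `W m`; once r^k is divided
  -- out, that product is invertible and cancels. Equality must be exact here, as `divR^ k` reads
  -- coefficients k places further on.
  qBinRatio≈gauss : ∀ j k → qBinRatio j k ≈ᴾ Q.gauss j k
  qBinRatio≈gauss j k = begin
    qBinRatio j k
      ≈⟨ C.*-cong numerator (invₚ-unique _ (SP.Π< k (invₚ ∘ W))
           (C.trans (C.*-congʳ {SP.Π< k (invₚ ∘ W)} denominator) U-inverse)) ⟩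
    Q.gauss j k *ₚ SP.Π< k W *ₚ SP.Π< k (invₚ ∘ W)
      ≈⟨ C.*-assoc (Q.gauss j k) (SP.Π< k W) (SP.Π< k (invₚ ∘ W)) ⟩
    Q.gauss j k *ₚ (SP.Π< k W *ₚ SP.Π< k (invₚ ∘ W))    ≈⟨ C.sym (SP.times-one (Q.gauss j k) U-inverse) ⟩
    Q.gauss j k                                         ∎
    where
    open Relation.Binary.Reasoning.Setoid C.setoid
    module I = IntegerSolver comparisonRing
    U-inverse : SP.Π< k W *ₚ SP.Π< k (invₚ ∘ W) ≈ᴾ 1ₚ
    U-inverse = SP.Π-inverse k W (invₚ ∘ W) (λ m → restrict (invₚ-inverse (W m)
      (λ W₀≈0 → charZero m (trans (sym (W-constant m)) W₀≈0))))
    denominator : divR^ k (poch q k) ≈ᴾ SP.Π< k W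
    denominator m n _ = trans (divR-cong k (λ m n → poch-q k m n tt) m n) (divR^-R^ k (SP.Π< k W) m n)
    numerator : divR^ k (poch (q ^ₚ j) k) ≈ᴾ Q.gauss j k *ₚ SP.Π< k W
    numerator m n _ = trans
      (divR-cong k (λ m n → C.trans
        (C.trans (C.reflexive (≡.trans (poch≡ (q ^ₚ j) k) (≡.cong (λ f → Q.poch f k) (^ₚ≡^ q j))))
          (Q.gauss-poch j k))
        (C.trans (C.*-congˡ {Q.gauss j k} (C.trans (C.reflexive (≡.sym (poch≡ q k))) (poch-q k)))
          (I.solve 3 (λ g r u → g I.:* (r I.:* u) I.:= r I.:* (g I.:* u)) C.refl
            (Q.gauss j k) (R SP.^ k) (SP.Π< k W))) m n tt) m n)
      (divR^-R^ k (Q.gauss j k *ₚ SP.Π< k W) m n)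

-- Division in the coefficient field

module FieldIdentities {ℓ₁ ℓ₂ : Level} (F : CharZeroField ℓ₁ ℓ₂) where
  open CharZeroField F
  open PowerSeries F
  open IntegerSolver commRing
  open SumsAndProducts commRing using (times-one)
  open Relation.Binary.Reasoning.Setoid setoid

  *-nonzero : ∀ {x y} → ¬ (x ≈ 0#) → ¬ (y ≈ 0#) → ¬ (x * y ≈ 0#)
  *-nonzero {x} {y} x≉0 y≉0 xy≈0 = y≉0 (begin
    y                   ≈⟨ times-one y (⁻¹-inverse x x≉0) ⟩
    y * (x * x ⁻¹)      ≈⟨ solve 3 (λ x y z → y :* (x :* z) := x :* y :* z) refl x y (x ⁻¹) ⟩
    x * y * x ⁻¹        ≈⟨ trans (*-congʳ xy≈0) (zeroˡ _) ⟩
    0#                  ∎)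

  ÷-*-cancel : ∀ x {y} → ¬ (y ≈ 0#) → x ÷ y * y ≈ x
  ÷-*-cancel x {y} y≉0 = trans (solve 3 (λ x y z → x :* z :* y := x :* (y :* z)) refl x y (y ⁻¹))
    (sym (times-one x (⁻¹-inverse y y≉0)))

  ÷-unique : ∀ {x y z} → ¬ (y ≈ 0#) → z * y ≈ x → x ÷ y ≈ z
  ÷-unique {x} {y} {z} y≉0 zy≈x = begin
    x * y ⁻¹            ≈⟨ *-congʳ (sym zy≈x) ⟩
    z * y * y ⁻¹        ≈⟨ *-assoc _ _ _ ⟩
    z * (y * y ⁻¹)      ≈⟨ sym (times-one z (⁻¹-inverse y y≉0)) ⟩
    z                   ∎

-- From the ring identity to the series

module Assembly {ℓ₁ ℓ₂ : Level} (F : CharZeroField ℓ₁ ℓ₂) where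
  open CharZeroField F
  open PowerSeries F
  open FieldIdentities F
  open DoubleSeries F

  module Modulo
      (b c d e : Carrier) (j : ℕ)
      (b≉0 : ¬ (b ≈ 0#)) (c≉0 : ¬ (c ≈ 0#)) (d≉0 : ¬ (d ≈ 0#)) (e≉0 : ¬ (e ≈ 0#))
      (1-d≉0 : ¬ (1# - d ≈ 0#)) (1-e≉0 : ¬ (1# - e ≈ 0#))
      (1-y≉0 : ¬ (1# - (b * c) ÷ (d * e) ≈ 0#)) (1-X≉0 : ¬ (1# - (d * e) ÷ (b * c) ≈ 0#))
      (1-ε≉0 : ¬ (1# - 1# ÷ e ≈ 0#)) (N : ℕ)
    where

    open Truncation N
    open Reciprocals F (λ m n → m ℕ.+ n ℕ.≤ N) ℕ.z≤n
      (λ i≤m k≤n → ℕ.≤-trans (ℕ.+-mono-≤ i≤m k≤n))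
    module FS = IntegerSolver commRing
    module Tr = Transformation comparisonRing q

    bc≉0 : ¬ (b * c ≈ 0#)
    bc≉0 = *-nonzero b≉0 c≉0

    de≉0 : ¬ (d * e ≈ 0#)
    de≉0 = *-nonzero d≉0 e≉0

    x ε y X : Carrier
    x = d ÷ (b * c)
    ε = 1# ÷ e
    y = (b * c) ÷ (d * e)
    X = (d * e) ÷ (b * c)

    α : PS
    α = 1ₚ -ₚ A

    const² : ∀ {u v w} → u * v ≈ w → const u *ₚ const v ≈ᴾ const w
    const² uv≈w = C.trans (restrict (const-* _ _)) (restrict (const-cong uv≈w))

    const³ : ∀ {u v w z} → u * v * w ≈ z → const u *ₚ const v *ₚ const w ≈ᴾ const z
    const³ {u} {v} {w} uvw≈z = C.trans (C.*-congʳ {const w} (restrict (const-* u v))) (const² uvw≈z)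

    xbc≈d : const x *ₚ const b *ₚ const c ≈ᴾ const d
    xbc≈d = const³ (trans (*-assoc _ _ _) (÷-*-cancel d bc≉0))

    xe≈X : const x *ₚ const e ≈ᴾ const X
    xe≈X = const² (sym (÷-unique bc≉0
      (trans (FS.solve 3 (λ x e p → x FS.:* e FS.:* p FS.:= x FS.:* p FS.:* e) refl x e (b * c))
        (*-congʳ (÷-*-cancel d bc≉0)))))

    xc≈d/b : const x *ₚ const c ≈ᴾ const (d ÷ b)
    xc≈d/b = const² (sym (÷-unique b≉0
      (trans (FS.solve 3 (λ x b c → x FS.:* c FS.:* b FS.:= x FS.:* (b FS.:* c)) refl x b c)
        (÷-*-cancel d bc≉0))))

    xb≈d/c : const x *ₚ const b ≈ᴾ const (d ÷ c)
    xb≈d/c = const² (sym (÷-unique c≉0 (trans (*-assoc _ _ _) (÷-*-cancel d bc≉0))))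

    eε≈1 : const e *ₚ const ε ≈ᴾ 1ₚ
    eε≈1 = const² (trans (*-comm e ε) (÷-*-cancel 1# e≉0))

    xey≈1 : const x *ₚ const e *ₚ const y ≈ᴾ 1ₚ
    xey≈1 = const³ (begin
      x * e * (b * c * (d * e) ⁻¹)
        ≈⟨ FS.solve 4 (λ x e p i → x FS.:* e FS.:* (p FS.:* i) FS.:= x FS.:* p FS.:* e FS.:* i) refl
             x e (b * c) ((d * e) ⁻¹) ⟩
      x * (b * c) * e * (d * e) ⁻¹   ≈⟨ *-congʳ (*-congʳ (÷-*-cancel d bc≉0)) ⟩
      d * e * (d * e) ⁻¹             ≈⟨ ⁻¹-inverse _ de≉0 ⟩
      1#                             ∎)
      where open Relation.Binary.Reasoning.Setoid setoid

    v : PS → ℕ → PS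
    v f m = invₚ (1ₚ -ₚ f *ₚ (q ^ₚ m))

    -- Here f is the parameter as the series in the theorem contain it, and g the form in which the
    -- abstract transformation meets it, such as xbc in place of d.
    v-inverse : ∀ f g {z} → ¬ (1# - z ≈ 0#) → f 0 0 ≈ z → g ≈ᴾ f → Tr.Inverses g (v f)
    v-inverse f g {z} 1-z≉0 f₀≈z g≈f m = C.trans (C.*-comm (v f m) (1ₚ -ₚ g *ₚ (q SP.^ m)))
      (C.trans (C.*-congʳ {v f m} (SP.1-‿cong
          (C.*-cong g≈f (C.reflexive (≡.sym (^ₚ≡^ q m))))))
        (restrict (factor-inverse f (λ ≈0 → 1-z≉0 (trans (+-congˡ (-‿cong (sym f₀≈z))) ≈0)) m)))

    q*-constant : ∀ f → (q *ₚ f) 0 0 ≈ f 0 0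
    q*-constant f = trans (constant q f) (trans
      (*-congʳ (FS.solve 1 (λ o → o FS.:- FS.:0 FS.:= o) refl 1#)) (*-identityˡ _))

    -- As q and α = 1 - a both have constant term 1, the conditions on 1 - y and 1 - ε cover the
    -- denominators that contain these extra factors.
    qα-constant : ∀ z → (q *ₚ α *ₚ const z) 0 0 ≈ z
    qα-constant z = trans (constant (q *ₚ α) (const z)) (trans (*-congʳ (trans (q*-constant α)
      (FS.solve 1 (λ o → o FS.:- FS.:0 FS.:= o) refl 1#))) (*-identityˡ z))

    vd ve vX vL vR vB : ℕ → PS
    vd = v (const d)
    ve = v (const e)
    vX = v (const X)
    vL = v (q *ₚ α *ₚ const y)
    vR = v (q *ₚ α *ₚ const ε)
    vB = v (q *ₚ const y)

    vd-inverse′ : Tr.Inverses (const d) vd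
    vd-inverse′ = v-inverse (const d) (const d) 1-d≉0 refl C.refl
    vd-inverse : Tr.Inverses (const x *ₚ const b *ₚ const c) vd
    vd-inverse = v-inverse (const d) (const x *ₚ const b *ₚ const c) 1-d≉0 refl xbc≈d
    ve-inverse : Tr.Inverses (const e) ve
    ve-inverse = v-inverse (const e) (const e) 1-e≉0 refl C.refl
    vX-inverse′ : Tr.Inverses (const X) vX
    vX-inverse′ = v-inverse (const X) (const X) 1-X≉0 refl C.refl
    vX-inverse : Tr.Inverses (const x *ₚ const e) vX
    vX-inverse = v-inverse (const X) (const x *ₚ const e) 1-X≉0 refl xe≈X
    vL-inverse : Tr.Inverses (q *ₚ α *ₚ const y) vL
    vL-inverse = v-inverse (q *ₚ α *ₚ const y) (q *ₚ α *ₚ const y) 1-y≉0 (qα-constant y) C.refl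
    vR-inverse : Tr.Inverses (q *ₚ α *ₚ const ε) vR
    vR-inverse = v-inverse (q *ₚ α *ₚ const ε) (q *ₚ α *ₚ const ε) 1-ε≉0 (qα-constant ε) C.refl
    vB-inverse : Tr.Inverses (q *ₚ const y) vB
    vB-inverse = v-inverse (q *ₚ const y) (q *ₚ const y) 1-y≉0 (q*-constant (const y)) C.refl

    q-unit : SP.Unit q
    q-unit = invₚ q , C.trans (C.*-comm (invₚ q) q) (restrict (invₚ-inverse q
      (λ q₀≈0 → 1≉0 (trans (FS.solve 1 (λ o → o FS.:= o FS.:- FS.:0) refl 1#) q₀≈0))))

    x-unit : SP.Unit (const x)
    x-unit = const e *ₚ const y , C.trans (C.*-comm (const e *ₚ const y) (const x))
      (C.trans (C.sym (C.*-assoc (const x) (const e) (const y))) xey≈1)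

    -- Order at least N+1 leaves no coefficient with m + n ≤ N; hence the cutoff `suc N`, that is,
    -- sums over k ≤ N.
    vanish : ∀ k → suc N ℕ.≤ k → Q.poch α k ≈ᴾ C.0#
    vanish k N<k = C.trans (C.reflexive (≡.sym (poch≡ α k)))
      (order-zero N (λ m n m+n<N → poch-order k m n (ℕ.≤-trans m+n<N N<k)))

    module M = Tr.Parameters j (suc N) α (const b) (const c) (const x) (const e) (const ε) (const y)
      q-unit x-unit eε≈1 xey≈1 vd ve vX vL vR vB
      vd-inverse ve-inverse vX-inverse vL-inverse vR-inverse vB-inverse vanish

    -- The exact and the truncated ring share all operations and differ only in equality, but their
    -- binomials are separate recursions, to be matched step by step.
    gauss≡ : ∀ j k → Exact.Q.gauss j k ≡ Q.gauss j k
    gauss≡ zero    zero    = ≡.refl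
    gauss≡ (suc j) zero    = ≡.refl
    gauss≡ zero    (suc k) = ≡.refl
    gauss≡ (suc j) (suc k) = ≡.cong₂ _+ₚ_ (gauss≡ j (suc k))
      (≡.cong₂ _*ₚ_ (≡.trans (≡.sym (Exact.^ₚ≡^ q j)) (^ₚ≡^ q j)) (gauss≡ (suc j) k))

    qBinRatio≈ : ∀ k → qBinRatio j k ≈ᴾ Q.gauss j k
    qBinRatio≈ k = C.trans (λ m n _ → GaussianBinomials.qBinRatio≈gauss F j k m n tt)
      (C.reflexive (gauss≡ j k))

    poch-inverse : ∀ {f w} → Tr.Inverses f w → ∀ k → poch f k *ₚ SP.Π< k w ≈ᴾ 1ₚ
    poch-inverse {f} {w} w-inverse k =
      C.trans (C.*-congʳ {SP.Π< k w} (C.reflexive (poch≡ f k))) (Tr.poch-inverse w-inverse k)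

    shifted-poch-inverse : ∀ z {w} → Tr.Inverses (q *ₚ α *ₚ z) w → ∀ k →
      poch ((q ^ₚ suc j) *ₚ α *ₚ z) k *ₚ SP.Π< k (λ m → w (j ℕ.+ m)) ≈ᴾ 1ₚ
    shifted-poch-inverse z {w} w-inverse k =
      C.trans (C.*-congʳ {SP.Π< k (λ m → w (j ℕ.+ m))} (C.reflexive (≡.trans
          (≡.cong (λ g → poch (g *ₚ α *ₚ z) k) (^ₚ≡^ q (suc j))) (poch≡ _ k))))
        (Tr.shifted-poch-inverse {α} {z} {w} w-inverse j k)

    inverse-product : ∀ f f′ g g′ → f *ₚ g ≈ᴾ 1ₚ → f′ *ₚ g′ ≈ᴾ 1ₚ → (f *ₚ f′) *ₚ (g *ₚ g′) ≈ᴾ 1ₚ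
    inverse-product f f′ g g′ fg≈1 f′g′≈1 = C.trans
      (I.solve 4 (λ f f′ g g′ → (f I.:* f′) I.:* (g I.:* g′) I.:= (f I.:* g) I.:* (f′ I.:* g′))
        C.refl f f′ g g′)
      (C.trans (C.*-cong fg≈1 f′g′≈1) (C.*-identityˡ 1ₚ))
      where module I = IntegerSolver comparisonRing

    poch-const : ∀ {f} z → f ≈ᴾ const z → ∀ k → poch (const z) k ≈ᴾ Q.poch f k
    poch-const z f≈z k = C.trans (C.reflexive (poch≡ (const z) k)) (Q.poch-cong (C.sym f≈z) k)

    lhs-summand rhs-summand : ℕ → PS
    lhs-summand k =
      qBinRatio j k *ₚ poch α k *ₚ poch (const b) k *ₚ poch (const c) k *ₚ (q ^ₚ k)
        *ₚ invₚ (poch (const d) k *ₚ poch (const e) k *ₚ poch ((q ^ₚ suc j) *ₚ α *ₚ const y) k)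
    rhs-summand k =
      qBinRatio j k *ₚ poch α k *ₚ poch (const (d ÷ b)) k *ₚ poch (const (d ÷ c)) k *ₚ (q ^ₚ k)
        *ₚ invₚ (poch (const d) k *ₚ poch (const X) k *ₚ poch ((q ^ₚ suc j) *ₚ α *ₚ const ε) k)

    -- The order comes from the factor (1-a;q)_k alone.
    summand-order : ∀ k f g h i → Order≥ k (qBinRatio j k *ₚ poch α k *ₚ f *ₚ g *ₚ h *ₚ i)
    summand-order k f g h i = order-*ʳ i (order-*ʳ h (order-*ʳ g (order-*ʳ f
      (order-*ˡ (qBinRatio j k) (poch-order k)))))

    lhs : ∀ k → lhs-summand k ≈ᴾ M.lhs-term k
    lhs k = Tr.summand-cong (qBinRatio j k) (Q.gauss j k) (poch α k) (Q.poch α k)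
      (poch (const b) k) (Q.poch (const b) k) (poch (const c) k) (Q.poch (const c) k) (q ^ₚ k) (q SP.^ k)
      (invₚ P) I (qBinRatio≈ k) (C.reflexive (poch≡ α k))
      (C.reflexive (poch≡ (const b) k)) (C.reflexive (poch≡ (const c) k)) (C.reflexive (^ₚ≡^ q k))
      (invₚ-unique P I (inverse-product
          (poch (const d) k *ₚ poch (const e) k) (poch ((q ^ₚ suc j) *ₚ α *ₚ const y) k)
          (SP.Π< k vd *ₚ SP.Π< k ve) (SP.Π< k (λ m → vL (j ℕ.+ m)))
          (inverse-product (poch (const d) k) (poch (const e) k) (SP.Π< k vd) (SP.Π< k ve)
            (poch-inverse vd-inverse′ k) (poch-inverse ve-inverse k))
          (shifted-poch-inverse (const y) vL-inverse k)))
      where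
      P = poch (const d) k *ₚ poch (const e) k *ₚ poch ((q ^ₚ suc j) *ₚ α *ₚ const y) k
      I = SP.Π< k vd *ₚ SP.Π< k ve *ₚ SP.Π< k (λ m → vL (j ℕ.+ m))

    rhs : ∀ k → rhs-summand k ≈ᴾ M.rhs-term k
    rhs k = Tr.summand-cong (qBinRatio j k) (Q.gauss j k) (poch α k) (Q.poch α k)
      (poch (const (d ÷ b)) k) (Q.poch (const x *ₚ const c) k)
      (poch (const (d ÷ c)) k) (Q.poch (const x *ₚ const b) k) (q ^ₚ k) (q SP.^ k)
      (invₚ P) I (qBinRatio≈ k) (C.reflexive (poch≡ α k))
      (poch-const (d ÷ b) xc≈d/b k) (poch-const (d ÷ c) xb≈d/c k) (C.reflexive (^ₚ≡^ q k))
      (invₚ-unique P I (inverse-product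
          (poch (const d) k *ₚ poch (const X) k) (poch ((q ^ₚ suc j) *ₚ α *ₚ const ε) k)
          (SP.Π< k vd *ₚ SP.Π< k vX) (SP.Π< k (λ m → vR (j ℕ.+ m)))
          (inverse-product (poch (const d) k) (poch (const X) k) (SP.Π< k vd) (SP.Π< k vX)
            (poch-inverse vd-inverse′ k) (poch-inverse vX-inverse′ k))
          (shifted-poch-inverse (const ε) vR-inverse k)))
      where
      P = poch (const d) k *ₚ poch (const X) k *ₚ poch ((q ^ₚ suc j) *ₚ α *ₚ const ε) k
      I = SP.Π< k vd *ₚ SP.Π< k vX *ₚ SP.Π< k (λ m → vR (j ℕ.+ m))

    pref : prefactor b c d e j ≈ᴾ M.pref
    pref = C.*-cong
      (C.*-cong (C.reflexive (poch≡ (q *ₚ const ε) j)) (C.reflexive (poch≡ (q *ₚ α *ₚ const y) j)))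
      (invₚ-unique (poch (q *ₚ α *ₚ const ε) j *ₚ poch (q *ₚ const y) j) (SP.Π< j vR *ₚ SP.Π< j vB)
        (inverse-product (poch (q *ₚ α *ₚ const ε) j) (poch (q *ₚ const y) j) (SP.Π< j vR) (SP.Π< j vB)
          (poch-inverse vR-inverse j) (poch-inverse vB-inverse j)))

    lhs-order : ∀ k → Order≥ k (lhs-summand k)
    lhs-order k = summand-order k (poch (const b) k) (poch (const c) k) (q ^ₚ k)
      (invₚ (poch (const d) k *ₚ poch (const e) k *ₚ poch ((q ^ₚ suc j) *ₚ α *ₚ const y) k))

    rhs-order : ∀ k → Order≥ k (rhs-summand k)
    rhs-order k = summand-order k (poch (const (d ÷ b)) k) (poch (const (d ÷ c)) k) (q ^ₚ k)
      (invₚ (poch (const d) k *ₚ poch (const X) k *ₚ poch ((q ^ₚ suc j) *ₚ α *ₚ const ε) k))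

    lhs-sum : tsum lhs-summand ≈ᴾ SP.Σ< (suc N) M.lhs-term
    lhs-sum = C.trans {tsum lhs-summand} {SP.Σ< (suc N) lhs-summand} {SP.Σ< (suc N) M.lhs-term}
      (tsum-truncation N lhs-summand lhs-order) (SP.Σ-cong (suc N) {lhs-summand} {M.lhs-term} lhs)

    rhs-sum : tsum rhs-summand ≈ᴾ SP.Σ< (suc N) M.rhs-term
    rhs-sum = C.trans {tsum rhs-summand} {SP.Σ< (suc N) rhs-summand} {SP.Σ< (suc N) M.rhs-term}
      (tsum-truncation N rhs-summand rhs-order) (SP.Σ-cong (suc N) {rhs-summand} {M.rhs-term} rhs)

    rhs-product : prefactor b c d e j *ₚ tsum rhs-summand ≈ᴾ M.pref *ₚ SP.Σ< (suc N) M.rhs-term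
    rhs-product = C.*-cong {prefactor b c d e j} {M.pref} {tsum rhs-summand} {SP.Σ< (suc N) M.rhs-term}
      pref rhs-sum

    transformation : LHS b c d e j ≈ᴾ RHS b c d e j
    transformation m n m+n≤N = begin
      tsum lhs-summand m n                             ≈⟨ lhs-sum m n m+n≤N ⟩
      SP.Σ< (suc N) M.lhs-term m n                     ≈⟨ M.transformation m n m+n≤N ⟩
      (M.pref *ₚ SP.Σ< (suc N) M.rhs-term) m n         ≈⟨ sym (rhs-product m n m+n≤N) ⟩
      (prefactor b c d e j *ₚ tsum rhs-summand) m n    ∎
      where open Relation.Binary.Reasoning.Setoid setoid

theorem7 : ∀ {ℓ₁ ℓ₂ : Level} (F : CharZeroField ℓ₁ ℓ₂) →
    let open CharZeroField F
        open PowerSeries F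
    in ∀ (b c d e : Carrier) (j : ℕ) →
       ¬ (b ≈ 0#) → ¬ (c ≈ 0#) → ¬ (d ≈ 0#) → ¬ (e ≈ 0#) →
       ¬ (1# - d ≈ 0#) → ¬ (1# - e ≈ 0#) →
       ¬ (1# - (b * c) ÷ (d * e) ≈ 0#) → ¬ (1# - (d * e) ÷ (b * c) ≈ 0#) →
       ¬ (1# - 1# ÷ e ≈ 0#) →
       LHS b c d e j ≈ₚ RHS b c d e j
-- Each coefficient is compared at its own truncation order N = m + n.
theorem7 F b c d e j b≉0 c≉0 d≉0 e≉0 1-d≉0 1-e≉0 1-y≉0 1-X≉0 1-ε≉0 m n =
  Assembly.Modulo.transformation F b c d e j b≉0 c≉0 d≉0 e≉0 1-d≉0 1-e≉0 1-y≉0 1-X≉0 1-ε≉0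
    (m ℕ.+ n) m n ℕ.≤-refl
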